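{- Let $0<\varepsilon<10^{ -3}$, $k = 2^{20/\varepsilon}$ and $n>k^2$. Suppose $G$ is any multigraph with edge multiplicities at most $n/k$ that is properly edge-coloured with $n$ colours so that every colour appears at least $(1+\varepsilon)n$ times. Then $G$ has a rainbow matching of size $n-k$.
   Context: A proper edge-colouring of a multigraph is an assignment of colours to edges (parallel edges counted separately) such that any two edges sharing an endpoint receive different colours. A matching is rainbow if no two of its edges have the same colour.
   Formalization: The formal theorem takes ε to be a rational number p/q with 0 < ε < 10^{ -3}, rather than an arbitrary real number; k = 2^{20/ε} is still compared exactly, and a rainbow matching of size n−k means one with at least n−k edges. -}

module Defs where

open import Data.Nat using (ℕ; zero; suc; _+_; _*_; _∸_; _^_; _≤_; _<_)
open import Data.Fin using (Fin; _≟_)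
open import Data.List using (List; length; filter; allFin)
open import Data.List.Relation.Unary.AllPairs using (AllPairs)
open import Data.Product using (_×_; _,_; proj₁; proj₂)
open import Data.Sum using (_⊎_)
open import Relation.Binary.PropositionalEquality using (_≡_; _≢_)
open import Relation.Nullary using (¬_; Dec)
open import Relation.Nullary.Decidable using (_×-dec_; _⊎-dec_)

-- A finite loopless multigraph: vertices Fin V, edges Fin E (parallel edges
-- are distinct elements of Fin E), each edge with two distinct endpoints.
record MultiGraph : Set where
  field
    V : ℕ
    E : ℕ
    ends : Fin E → Fin V × Fin V
    loopless : ∀ e → proj₁ (ends e) ≢ proj₂ (ends e)

open MultiGraph public

count : (m : ℕ) {P : Fin m → Set} → (∀ i → Dec (P i)) → ℕ
count m P? = length (filter P? (allFin m))

Incident : (G : MultiGraph) → Fin (E G) → Fin (V G) → Set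
Incident G e x = (proj₁ (ends G e) ≡ x) ⊎ (proj₂ (ends G e) ≡ x)

ShareEndpoint : (G : MultiGraph) → Fin (E G) → Fin (E G) → Set
ShareEndpoint G e f = (Incident G f (proj₁ (ends G e))) ⊎ (Incident G f (proj₂ (ends G e)))

Joins : (G : MultiGraph) → Fin (E G) → Fin (V G) → Fin (V G) → Set
Joins G e u w = ((proj₁ (ends G e) ≡ u) × (proj₂ (ends G e) ≡ w))
              ⊎ ((proj₁ (ends G e) ≡ w) × (proj₂ (ends G e) ≡ u))

joins? : (G : MultiGraph) (u w : Fin (V G)) (e : Fin (E G)) → Dec (Joins G e u w)
joins? G u w e = ((proj₁ (ends G e) ≟ u) ×-dec (proj₂ (ends G e) ≟ w))
           ⊎-dec ((proj₁ (ends G e) ≟ w) ×-dec (proj₂ (ends G e) ≟ u))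

multiplicity : (G : MultiGraph) → Fin (V G) → Fin (V G) → ℕ
multiplicity G u w = count (E G) (joins? G u w)

ProperColouring : (G : MultiGraph) (n : ℕ) → (Fin (E G) → Fin n) → Set
ProperColouring G n col = ∀ e f → e ≢ f → ShareEndpoint G e f → col e ≢ col f

colourCount : (G : MultiGraph) {n : ℕ} → (Fin (E G) → Fin n) → Fin n → ℕ
colourCount G col c = count (E G) (λ e → col e ≟ c)

IsMatching : (G : MultiGraph) → List (Fin (E G)) → Set
IsMatching G M = AllPairs (λ e f → e ≢ f × ¬ ShareEndpoint G e f) M

IsRainbow : (G : MultiGraph) {n : ℕ} → (Fin (E G) → Fin n) → List (Fin (E G)) → Set
IsRainbow G col M = AllPairs (λ e f → col e ≢ col f) M

-- The parameter ε is the rational p / q (p, q ≥ 1) and k = 2^(20/ε) = 2^(20q/p)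
-- (generally not an integer).  Comparisons with k are encoded exactly in ℕ
-- by raising both (nonnegative) sides to the p-th power.

AtMostK : (p q x : ℕ) → Set
AtMostK p q x = x ^ p ≤ 2 ^ (20 * q)

GreaterThanKSq : (p q n : ℕ) → Set
GreaterThanKSq p q n = 2 ^ (40 * q) < n ^ p

-- m ≤ n / k  ⇔  m * k ≤ n  ⇔  m^p * 2^(20q) ≤ n^p
AtMostNOverK : (p q n m : ℕ) → Set
AtMostNOverK p q n m = m ^ p * 2 ^ (20 * q) ≤ n ^ p

-- s ≥ n - k  ⇔  n ∸ s ≤ k
AtLeastNMinusK : (p q n s : ℕ) → Set
AtLeastNMinusK p q n s = AtMostK p q (n ∸ s)

{-# OPTIONS --safe #-}
module Submission where

-- Let M be a rainbow matching with s < n − k edges that no rainbow matching exceeds.  If the edges of a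
-- rainbow matching Y touch, by a vertex or a colour, only a set P of edges of M, then exchanging P for Y
-- shows |Y| ≤ |P|.  Grow a set of releasable edges of M: such an edge can be traded for another one at its
-- tail, which frees its colour and its head.  At level 0 the trade uses one of the more than k unused colours
-- and a vertex outside M reserved for that edge; at level j + 1 it uses the colour and the head of edges of
-- level j, so it takes about 2^j exchanges in all.  No edge of a free colour joins two free vertices, as the
-- exchanges would enlarge M.  Hence each free colour class, having (1 + ε)n edges, sends about 2εn edges from
-- the part of M not yet releasable to free vertices; by averaging, about εn/2 new edges of M see many free
-- colours, and the multiplicity bound lets them avoid the few vertices and edges already in use.  After 2/ε
-- levels M is used up, while all exchanges together involve 2^O(1/ε), far fewer than k, edges.

open import Defs
open import Data.Nat using (ℕ; zero; suc; _+_; _*_; _∸_; _^_; _≤_; _<_; z≤n; s≤s; _≤?_; NonZero; >-nonZero)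
open import Data.Nat.Properties hiding (_≟_)
open import Data.Nat.DivMod using (_/_; _%_; n/n≡1; /-monoˡ-≤; m/n*n≤m; m≡m%n+[m/n]*n; m%n<n; m*n/n≡m; m<n*o⇒m/o<n)
open import Data.Nat.Tactic.RingSolver using (solve-∀)
open import Data.Fin using (Fin; zero; suc; _≟_)
import Data.Fin.Properties as Fin
open import Data.Bool using (Bool; true; false; not)
import Data.Bool.Properties as Bool
import Data.Maybe.Properties as Maybe
open import Data.Maybe using (Maybe; just; nothing)
open import Data.List using (List; []; _∷_; length; map; filter; allFin; tabulate; lookup; take; _++_)
import Data.List.Properties as List
open import Data.List.Relation.Unary.All as All using (All; []; _∷_)
import Data.List.Relation.Unary.All.Properties as All
open import Data.List.Relation.Unary.Any as Any using (Any; here; there)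
open import Data.List.Relation.Unary.AllPairs as AllPairs using (AllPairs; []; _∷_)
import Data.List.Relation.Unary.AllPairs.Properties as AllPairs
open import Data.List.Membership.Propositional using (_∈_; _∉_)
open import Data.List.Membership.Propositional.Properties using (∈-map⁺; ∈-map⁻; ∈-++⁺ˡ; ∈-++⁺ʳ; ∈-++⁻; ∈-lookup)
open import Data.Product using (Σ; ∃; _×_; _,_; proj₁; proj₂)
open import Data.Sum using (_⊎_; inj₁; inj₂; [_,_]′)
import Data.Sum as Sum
open import Data.Empty using (⊥; ⊥-elim)
open import Function using (_∘_; id)
open import Relation.Binary.PropositionalEquality using (_≡_; _≢_; refl; sym; trans; cong; cong₂; subst; module ≡-Reasoning)
open import Relation.Nullary using (¬_; Dec; yes; no)
open import Relation.Nullary.Decidable using (_×-dec_; _⊎-dec_; ¬?; map′; decidable-stable; toWitness)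
open import Algebra.Properties.Semiring.Sum +-*-semiring
  using (sum; sum-cong-≗; ∑-distrib-+; ∑-comm; *-distribˡ-sum; *-distribʳ-sum)

-- Sums of indicators

⟦_⟧ : ∀ {P : Set} → Dec P → ℕ
⟦ yes _ ⟧ = 1
⟦ no _ ⟧ = 0

⟦⟧≤1 : ∀ {P : Set} (d : Dec P) → ⟦ d ⟧ ≤ 1
⟦⟧≤1 (yes _) = ≤-refl
⟦⟧≤1 (no _) = z≤n

⟦⟧-true : ∀ {P : Set} (d : Dec P) → P → ⟦ d ⟧ ≡ 1
⟦⟧-true (yes _) _ = refl
⟦⟧-true (no ¬p) p = ⊥-elim (¬p p)

⟦⟧-false : ∀ {P : Set} (d : Dec P) → ¬ P → ⟦ d ⟧ ≡ 0
⟦⟧-false (yes p) ¬p = ⊥-elim (¬p p)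
⟦⟧-false (no _) _ = refl

⟦⟧-mono : ∀ {P Q : Set} (d : Dec P) (e : Dec Q) → (P → Q) → ⟦ d ⟧ ≤ ⟦ e ⟧
⟦⟧-mono (yes p) e f = ≤-reflexive (sym (⟦⟧-true e (f p)))
⟦⟧-mono (no _) _ _ = z≤n

⟦⟧-⊎ : ∀ {P Q R : Set} (d : Dec P) (e : Dec Q) (f : Dec R) → (P → Q ⊎ R) → ⟦ d ⟧ ≤ ⟦ e ⟧ + ⟦ f ⟧
⟦⟧-⊎ (no _) _ _ _ = z≤n
⟦⟧-⊎ (yes p) e f g with g p
... | inj₁ q = ≤-trans (≤-reflexive (sym (⟦⟧-true e q))) (m≤m+n _ _)
... | inj₂ r = ≤-trans (≤-reflexive (sym (⟦⟧-true f r))) (m≤n+m _ _)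

⟦⟧-× : ∀ {P Q : Set} (d : Dec P) (e : Dec Q) → ⟦ d ×-dec e ⟧ ≡ ⟦ d ⟧ * ⟦ e ⟧
⟦⟧-× (yes p) (yes q) = refl
⟦⟧-× (yes p) (no ¬q) = refl
⟦⟧-× (no ¬p) e = refl

sum-mono : ∀ {m} {f g : Fin m → ℕ} → (∀ i → f i ≤ g i) → sum f ≤ sum g
sum-mono {zero} le = z≤n
sum-mono {suc m} le = +-mono-≤ (le zero) (sum-mono (le ∘ suc))

sum-const : ∀ m k → sum {m} (λ _ → k) ≡ m * k
sum-const zero k = refl
sum-const (suc m) k = cong (k +_) (sum-const m k)

sum-zero : ∀ {m} {f : Fin m → ℕ} → (∀ i → f i ≡ 0) → sum f ≡ 0
sum-zero {zero} z = refl
sum-zero {suc m} z = cong₂ _+_ (z zero) (sum-zero (z ∘ suc))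

term≤sum : ∀ {m} (f : Fin m → ℕ) i → f i ≤ sum f
term≤sum f zero = m≤m+n _ _
term≤sum f (suc i) = ≤-trans (term≤sum (f ∘ suc) i) (m≤n+m _ _)

two≤sum : ∀ {m} (f : Fin m → ℕ) {i j} → i ≢ j → f i + f j ≤ sum f
two≤sum f {zero} {zero} ne = ⊥-elim (ne refl)
two≤sum f {zero} {suc j} ne = +-monoʳ-≤ (f zero) (term≤sum (f ∘ suc) j)
two≤sum f {suc i} {zero} ne =
  ≤-trans (≤-reflexive (+-comm _ (f zero))) (+-monoʳ-≤ (f zero) (term≤sum (f ∘ suc) i))
two≤sum f {suc i} {suc j} ne =
  ≤-trans (two≤sum (f ∘ suc) (ne ∘ cong suc)) (m≤n+m _ _)

-- Pigeonhole: applied to two indicators, it produces an element of the larger set that lies outside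
-- the smaller one.
exceeds : ∀ {m} {f g : Fin m → ℕ} → sum g < sum f → ∃ λ i → g i < f i
exceeds {f = f} {g} lt with Fin.any? (λ i → suc (g i) ≤? f i)
... | yes w = w
... | no none = ⊥-elim (<⇒≱ lt (sum-mono λ i → ≮⇒≥ λ l → none (i , l)))

⟦⟧-exceeds : ∀ {P : Set} (d : Dec P) {k} → k < ⟦ d ⟧ → P × k ≡ 0
⟦⟧-exceeds (yes p) (s≤s z≤n) = p , refl

⟦⟧≡0 : ∀ {P : Set} (d : Dec P) → ⟦ d ⟧ ≡ 0 → ¬ P
⟦⟧≡0 (no ¬p) _ = ¬p

sum≤1 : ∀ {m} {P : Fin m → Set} (P? : ∀ i → Dec (P i)) →
  (∀ {i j} → P i → P j → i ≡ j) → sum (λ i → ⟦ P? i ⟧) ≤ 1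
sum≤1 {zero} P? uniq = z≤n
sum≤1 {suc m} P? uniq with P? zero
... | no _ = sum≤1 (P? ∘ suc) (λ p q → Fin.suc-injective (uniq p q))
... | yes p = s≤s (≤-reflexive (sum-zero λ i → ⟦⟧-false (P? (suc i)) λ q → Fin.0≢1+n (uniq p q)))

sum-pick : ∀ {m} (a : Fin m) (h : Fin m → ℕ) → sum (λ v → ⟦ a ≟ v ⟧ * h v) ≤ h a
sum-pick a h = begin
  sum (λ v → ⟦ a ≟ v ⟧ * h v)  ≤⟨ sum-mono (λ v → same v) ⟩
  sum (λ v → h a * ⟦ a ≟ v ⟧)  ≡⟨ sym (*-distribˡ-sum (h a) (λ v → ⟦ a ≟ v ⟧)) ⟩
  h a * sum (λ v → ⟦ a ≟ v ⟧)  ≤⟨ *-monoʳ-≤ (h a) (sum≤1 (a ≟_) (λ p q → trans (sym p) q)) ⟩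
  h a * 1                      ≡⟨ *-identityʳ (h a) ⟩
  h a ∎
  where
  open ≤-Reasoning
  same : ∀ v → ⟦ a ≟ v ⟧ * h v ≤ h a * ⟦ a ≟ v ⟧
  same v with a ≟ v
  ... | yes refl = ≤-reflexive (*-comm 1 (h a))
  ... | no _ = z≤n

⟦∃⟧≤sum : ∀ {m} {P : Fin m → Set} (P? : ∀ i → Dec (P i)) (d : Dec (∃ P)) → ⟦ d ⟧ ≤ sum (λ i → ⟦ P? i ⟧)
⟦∃⟧≤sum P? (no _) = z≤n
⟦∃⟧≤sum P? (yes (i , p)) =
  ≤-trans (≤-reflexive (sym (⟦⟧-true (P? i) p))) (term≤sum (λ i → ⟦ P? i ⟧) i)

-- In a double count of the related pairs, every `i` in `A` accounts for at most one `j`.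
image-bound : ∀ {m k} {A : Fin m → Set} {R : Fin m → Fin k → Set}
  (A? : ∀ i → Dec (A i)) (R? : ∀ i j → Dec (R i j)) →
  (∀ i {j j′} → R i j → R i j′ → j ≡ j′) → (I? : ∀ j → Dec (∃ λ i → A i × R i j)) →
  sum (λ j → ⟦ I? j ⟧) ≤ sum (λ i → ⟦ A? i ⟧)
image-bound A? R? func I? = begin
  sum (λ j → ⟦ I? j ⟧)
    ≤⟨ sum-mono (λ j → ⟦∃⟧≤sum (λ i → A? i ×-dec R? i j) (I? j)) ⟩
  sum (λ j → sum (λ i → ⟦ A? i ×-dec R? i j ⟧))
    ≡⟨ ∑-comm (λ j i → ⟦ A? i ×-dec R? i j ⟧) ⟩
  sum (λ i → sum (λ j → ⟦ A? i ×-dec R? i j ⟧))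
    ≤⟨ sum-mono (λ i → each i) ⟩
  sum (λ i → ⟦ A? i ⟧) ∎
  where
  open ≤-Reasoning
  each : ∀ i → sum (λ j → ⟦ A? i ×-dec R? i j ⟧) ≤ ⟦ A? i ⟧
  each i with A? i
  ... | yes a = sum≤1 (λ j → yes a ×-dec R? i j) (λ p q → func i (proj₂ p) (proj₂ q))
  ... | no ¬a = ≤-reflexive (sum-zero λ j → ⟦⟧-false (no ¬a ×-dec R? i j) (¬a ∘ proj₁))

-- Union bound over the entries of `Z`.
list-bound : ∀ {A : Set} {m} {R : A → Fin m → Set} (R? : ∀ z i → Dec (R z i)) (k : ℕ) →
  (∀ z → sum (λ i → ⟦ R? z i ⟧) ≤ k) → ∀ Z (I? : ∀ i → Dec (Any (λ z → R z i) Z)) →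
  sum (λ i → ⟦ I? i ⟧) ≤ length Z * k
list-bound R? k bd [] I? =
  ≤-reflexive (sum-zero λ i → ⟦⟧-false (I? i) λ ())
list-bound R? k bd (z ∷ Z) I? = begin
  sum (λ i → ⟦ I? i ⟧)                            ≤⟨ sum-mono (λ i → ⟦⟧-⊎ (I? i) (R? z i) (J? i) Any.toSum) ⟩
  sum (λ i → ⟦ R? z i ⟧ + ⟦ J? i ⟧)               ≡⟨ ∑-distrib-+ (λ i → ⟦ R? z i ⟧) (λ i → ⟦ J? i ⟧) ⟩
  sum (λ i → ⟦ R? z i ⟧) + sum (λ i → ⟦ J? i ⟧)   ≤⟨ +-mono-≤ (bd z) (list-bound R? k bd Z J?) ⟩
  k + length Z * k ∎
  where
  open ≤-Reasoning
  J? : ∀ i → Dec (Any (λ z → _) Z)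
  J? i = Any.any? (λ z → R? z i) Z

_∈?_ : ∀ {m} (i : Fin m) (Z : List (Fin m)) → Dec (i ∈ Z)
i ∈? Z = Any.any? (i ≟_) Z

∈-bound : ∀ {m} (Z : List (Fin m)) → sum (λ i → ⟦ i ∈? Z ⟧) ≤ length Z
∈-bound Z = ≤-trans (list-bound (λ z i → i ≟ z) 1 (λ z → sum≤1 (_≟ z) (λ p q → trans p (sym q))) Z (_∈? Z))
                    (≤-reflexive (*-identityʳ _))

length-filter-tabulate : ∀ {A : Set} {m} {P : A → Set} (P? : ∀ a → Dec (P a)) (g : Fin m → A) →
  length (filter P? (tabulate g)) ≡ sum (λ i → ⟦ P? (g i) ⟧)
length-filter-tabulate {m = zero} P? g = refl
length-filter-tabulate {m = suc m} P? g with P? (g zero)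
... | yes _ = cong suc (length-filter-tabulate P? (g ∘ suc))
... | no _ = length-filter-tabulate P? (g ∘ suc)

count≡sum : ∀ m {P : Fin m → Set} (P? : ∀ i → Dec (P i)) → count m P? ≡ sum (λ i → ⟦ P? i ⟧)
count≡sum m P? = length-filter-tabulate P? id

-- Serves to reserve exactly `T` colours for a matching edge, so that the edge claims no more than
-- `T` vertices.
shrink : ∀ {m} {P : Fin m → Set} (P? : ∀ i → Dec (P i)) t → t ≤ sum (λ i → ⟦ P? i ⟧) →
  ∃ λ (sel : Fin m → Bool) → (∀ i → sel i ≡ true → P i) × sum (λ i → ⟦ sel i Bool.≟ true ⟧) ≡ t
shrink {zero} P? zero le = (λ ()) , (λ ()) , refl
shrink {suc m} P? t le with P? zero
shrink {suc m} P? t le | no _ with shrink (P? ∘ suc) t le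
... | sel , ok , eq = (λ { zero → false ; (suc i) → sel i }) , (λ { (suc i) → ok i }) , eq
shrink {suc m} P? zero le | yes p = (λ _ → false) , (λ _ ()) , sum-zero {suc m} (λ _ → refl)
shrink {suc m} P? (suc t) (s≤s le) | yes p with shrink (P? ∘ suc) t le
... | sel , ok , eq = (λ { zero → true ; (suc i) → sel i }) , (λ { zero _ → p ; (suc i) → ok i }) , cong suc eq

-- Counting edges between an edge set and a free vertex set

module Counting (G : MultiGraph) {n : ℕ} (col : Fin (E G) → Fin n) (proper : ProperColouring G n col) where

  joins-sym : ∀ {f u w} → Joins G f u w → Joins G f w u
  joins-sym (inj₁ (p , q)) = inj₂ (p , q)
  joins-sym (inj₂ (p , q)) = inj₁ (p , q)

  joins-incident : ∀ {f u w} → Joins G f u w → Incident G f u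
  joins-incident (inj₁ (p , q)) = inj₁ p
  joins-incident (inj₂ (p , q)) = inj₂ q

  incident-joins : ∀ {f u w v} → Joins G f u w → Incident G f v → v ≡ u ⊎ v ≡ w
  incident-joins (inj₁ (p , q)) (inj₁ r) = inj₁ (trans (sym r) p)
  incident-joins (inj₁ (p , q)) (inj₂ r) = inj₂ (trans (sym r) q)
  incident-joins (inj₂ (p , q)) (inj₁ r) = inj₂ (trans (sym r) p)
  incident-joins (inj₂ (p , q)) (inj₂ r) = inj₁ (trans (sym r) q)

  joins-≢ : ∀ {f u w} → Joins G f u w → u ≢ w
  joins-≢ {f} (inj₁ (p , q)) eq = loopless G f (trans p (trans eq (sym q)))
  joins-≢ {f} (inj₂ (p , q)) eq = loopless G f (trans p (trans (sym eq) (sym q)))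

  abstract
    incident? : ∀ f v → Dec (Incident G f v)
    incident? f v = (proj₁ (ends G f) ≟ v) ⊎-dec (proj₂ (ends G f) ≟ v)

  share : ∀ {e f v} → Incident G e v → Incident G f v → ShareEndpoint G e f
  share (inj₁ refl) i = inj₁ i
  share (inj₂ refl) i = inj₂ i

  shared : ∀ {e f} → ShareEndpoint G e f → ∃ λ v → Incident G e v × Incident G f v
  shared (inj₁ i) = _ , inj₁ refl , i
  shared (inj₂ i) = _ , inj₂ refl , i

  monochromatic-unique : ∀ {e f v} → col e ≡ col f → Incident G e v → Incident G f v → e ≡ f
  monochromatic-unique {e} {f} eq i j with e ≟ f
  ... | yes p = p
  ... | no ne = ⊥-elim (proper e f ne (share i j) eq)

  EdgeInto : (Fin (V G) → Set) → Fin n → Fin (V G) → Set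
  EdgeInto U c x = ∃ λ f → ∃ λ u → Joins G f x u × col f ≡ c × U u

  abstract
    edgeInto? : ∀ {U} → (∀ v → Dec (U v)) → ∀ c x → Dec (EdgeInto U c x)
    edgeInto? U? c x = Fin.any? λ f → Fin.any? λ u → joins? G x u f ×-dec ((col f ≟ c) ×-dec U? u)

  coloursInto : ∀ {U : Fin (V G) → Set} (U? : ∀ v → Dec (U v)) {m} (κ : Fin m → Fin n) {C : Fin m → Set} (C? : ∀ j → Dec (C j)) →
    Fin (V G) → ℕ
  coloursInto U? κ C? v = sum (λ j → ⟦ C? j ⟧ * ⟦ edgeInto? U? (κ j) v ⟧)

  Rich : ∀ {U : Fin (V G) → Set} (U? : ∀ v → Dec (U v)) {m} (κ : Fin m → Fin n) {C : Fin m → Set} (C? : ∀ j → Dec (C j)) →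
    ℕ → Fin (E G) → Set
  Rich U? κ C? θ e = θ ≤ coloursInto U? κ C? (proj₁ (ends G e)) ⊎ θ ≤ coloursInto U? κ C? (proj₂ (ends G e))

  rich? : ∀ {U : Fin (V G) → Set} (U? : ∀ v → Dec (U v)) {m} (κ : Fin m → Fin n) {C : Fin m → Set} (C? : ∀ j → Dec (C j)) →
    ∀ θ e → Dec (Rich U? κ C? θ e)
  rich? U? κ C? θ e = (θ ≤? _) ⊎-dec (θ ≤? _)

  NoEdgeInside : (Fin (V G) → Set) → Fin n → Set
  NoEdgeInside U c = ∀ f → col f ≡ c → ¬ (U (proj₁ (ends G f)) × U (proj₂ (ends G f)))

  -- In both applications `U` consists of the free vertices, `W` of the reserved vertices outside
  -- the matching, and `D` of the matching edges already labelled (none of them during the seeding).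
  module _ {U : Fin (V G) → Set} (U? : ∀ v → Dec (U v)) {W : Fin (V G) → Set} (W? : ∀ v → Dec (W v))
    {s : ℕ} (μ : Fin s → Fin (E G)) {D : Fin s → Set} (D? : ∀ i → Dec (D i))
    (cover : ∀ v → ¬ U v → W v ⊎ ∃ λ i → Incident G (μ i) v)
    (meets : ∀ i → D i → U (proj₁ (ends G (μ i))) ⊎ U (proj₂ (ends G (μ i)))) where

    private
      z : Fin n → Fin (V G) → ℕ
      z c v = ⟦ edgeInto? U? c v ⟧

      -- An edge of colour c with one end outside U is counted twice at that end.
      h : Fin n → Fin (V G) → ℕ
      h c v = ⟦ ¬? (U? v) ⟧ * (1 + z c v)

      h≤2 : ∀ c v → h c v ≤ 2
      h≤2 c v = *-mono-≤ (⟦⟧≤1 (¬? (U? v))) (s≤s (⟦⟧≤1 (edgeInto? U? c v)))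

      h≤1+z : ∀ c v → h c v ≤ 1 + z c v
      h≤1+z c v = ≤-trans (*-monoˡ-≤ (1 + z c v) (⟦⟧≤1 (¬? (U? v)))) (≤-reflexive (+-identityʳ _))

      h-inside : ∀ c v → U v → h c v ≡ 0
      h-inside c v u rewrite ⟦⟧-false (¬? (U? v)) (λ ¬u → ¬u u) = refl

    private module _ (c : Fin n) (noInside : NoEdgeInside U c) where

      -- With both ends outside `U`, each end gives 1; with one end outside, that end gives 2, since
      -- the edge itself witnesses `EdgeInto`. Both ends inside is excluded by `noInside`.
      edge-weight : ∀ f → col f ≡ c → 2 ≤ h c (proj₁ (ends G f)) + h c (proj₂ (ends G f))
      edge-weight f eq with U? (proj₁ (ends G f)) | U? (proj₂ (ends G f))
      ... | yes a | yes b = ⊥-elim (noInside f eq (a , b))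
      ... | no _ | no _ = s≤s (≤-trans (s≤s z≤n) (m≤n+m _ _))
      ... | yes a | no ¬b = ≤-reflexive (cong (λ k → suc (k + 0))
              (sym (⟦⟧-true (edgeInto? U? c _) (f , _ , inj₂ (refl , refl) , eq , a))))
      ... | no ¬a | yes b = ≤-reflexive (cong (λ k → suc (k + 0 + 0))
              (sym (⟦⟧-true (edgeInto? U? c _) (f , _ , inj₁ (refl , refl) , eq , b))))

      at : Fin (E G) → Fin (V G) → ℕ
      at f v = ⟦ (col f ≟ c) ×-dec incident? f v ⟧

      edge-weight-split : ∀ f → ⟦ col f ≟ c ⟧ * 2 ≤ sum (λ v → at f v * h c v)
      edge-weight-split f with col f ≟ c
      ... | no _ = z≤n
      ... | yes eq = ≤-trans (edge-weight f eq) (≤-trans (≤-reflexive (sym (cong₂ _+_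
              (one (inj₁ refl)) (one (inj₂ refl)))))
              (two≤sum (λ v → ⟦ yes eq ×-dec incident? f v ⟧ * h c v) (loopless G f)))
        where
        one : ∀ {v} → Incident G f v → ⟦ yes eq ×-dec incident? f v ⟧ * h c v ≡ h c v
        one {v} i = trans (cong (_* h c v) (⟦⟧-true (yes eq ×-dec incident? f v) (eq , i))) (+-identityʳ _)

      -- By properness a vertex lies on at most one edge of colour `c`, so the weights of different
      -- edges of the class are never charged to the same vertex.
      class-weight : sum (λ f → ⟦ col f ≟ c ⟧) * 2 ≤ sum (h c)
      class-weight = begin
        sum (λ f → ⟦ col f ≟ c ⟧) * 2
          ≡⟨ *-distribʳ-sum 2 (λ f → ⟦ col f ≟ c ⟧) ⟩
        sum (λ f → ⟦ col f ≟ c ⟧ * 2)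
          ≤⟨ sum-mono edge-weight-split ⟩
        sum (λ f → sum (λ v → at f v * h c v))
          ≡⟨ ∑-comm (λ f v → at f v * h c v) ⟩
        sum (λ v → sum (λ f → at f v * h c v))
          ≤⟨ sum-mono (λ v → ≤-trans (≤-reflexive (sym (*-distribʳ-sum (h c v) (λ f → at f v))))
               (≤-trans (*-monoˡ-≤ (h c v) (sum≤1 (λ f → (col f ≟ c) ×-dec incident? f v)
                 (λ p q → monochromatic-unique (trans (proj₁ p) (sym (proj₁ q))) (proj₂ p) (proj₂ q))))
                 (≤-reflexive (+-identityʳ _)))) ⟩
        sum (h c) ∎
        where open ≤-Reasoning

      -- An edge of `D` has an end in `U`, of weight 0, and the other end weighs at most 2. For any
      -- other edge the excess over 2 is the number of its ends joined to `U` in colour `c`.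
      ends-weight : ∀ i → h c (proj₁ (ends G (μ i))) + h c (proj₂ (ends G (μ i)))
                        ≤ 2 + ⟦ ¬? (D? i) ⟧ * (z c (proj₁ (ends G (μ i))) + z c (proj₂ (ends G (μ i))))
      ends-weight i with D? i
      ... | no _ = ≤-trans (+-mono-≤ (h≤1+z c a₁) (h≤1+z c a₂)) (≤-reflexive (rearrange (z c a₁) (z c a₂)))
        where
        a₁ = proj₁ (ends G (μ i))
        a₂ = proj₂ (ends G (μ i))
        rearrange : ∀ a b → (1 + a) + (1 + b) ≡ 2 + (a + b + 0)
        rearrange = solve-∀
      ... | yes d with meets i d
      ... | inj₁ u = ≤-trans (≤-reflexive (cong (_+ h c (proj₂ (ends G (μ i)))) (h-inside c (proj₁ (ends G (μ i))) u))) (h≤2 c (proj₂ (ends G (μ i))))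
      ... | inj₂ u = ≤-trans (≤-reflexive (trans (cong (h c (proj₁ (ends G (μ i))) +_) (h-inside c (proj₂ (ends G (μ i))) u)) (+-identityʳ _))) (h≤2 c (proj₁ (ends G (μ i))))

      vertex-weight : ∀ v → h c v ≤ ⟦ W? v ⟧ * 2 +
        sum (λ i → ⟦ proj₁ (ends G (μ i)) ≟ v ⟧ * h c v + ⟦ proj₂ (ends G (μ i)) ≟ v ⟧ * h c v)
      vertex-weight v with U? v
      ... | yes _ = z≤n
      ... | no ¬u with cover v ¬u
      ...   | inj₁ w rewrite ⟦⟧-true (W? v) w =
              ≤-trans (≤-trans (≤-reflexive (+-identityʳ _)) (s≤s (⟦⟧≤1 (edgeInto? U? c v)))) (m≤m+n 2 _)
      ...   | inj₂ (i , inc) = ≤-trans (here-it inc) (≤-trans (term≤sum _ i) (m≤n+m _ _))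
        where
        H = 1 * (1 + z c v)
        here-it : Incident G (μ i) v →
          H ≤ ⟦ proj₁ (ends G (μ i)) ≟ v ⟧ * H + ⟦ proj₂ (ends G (μ i)) ≟ v ⟧ * H
        here-it (inj₁ e) rewrite ⟦⟧-true (proj₁ (ends G (μ i)) ≟ v) e =
          ≤-trans (≤-reflexive (sym (+-identityʳ H))) (m≤m+n _ _)
        here-it (inj₂ e) rewrite ⟦⟧-true (proj₂ (ends G (μ i)) ≟ v) e =
          ≤-trans (≤-reflexive (sym (+-identityʳ H))) (m≤n+m _ _)

      total-weight : sum (h c) ≤ sum (λ v → ⟦ W? v ⟧) * 2 + (s * 2 +
        sum (λ i → ⟦ ¬? (D? i) ⟧ * (z c (proj₁ (ends G (μ i))) + z c (proj₂ (ends G (μ i))))))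
      total-weight = begin
        sum (h c)
          ≤⟨ sum-mono vertex-weight ⟩
        sum (λ v → ⟦ W? v ⟧ * 2 + sum (λ i → A i v + B i v))
          ≡⟨ ∑-distrib-+ (λ v → ⟦ W? v ⟧ * 2) (λ v → sum (λ i → A i v + B i v)) ⟩
        sum (λ v → ⟦ W? v ⟧ * 2) + sum (λ v → sum (λ i → A i v + B i v))
          ≡⟨ cong₂ _+_ (sym (*-distribʳ-sum 2 (λ v → ⟦ W? v ⟧))) (∑-comm (λ v i → A i v + B i v)) ⟩
        sum (λ v → ⟦ W? v ⟧) * 2 + sum (λ i → sum (λ v → A i v + B i v))
          ≤⟨ +-monoʳ-≤ _ (sum-mono λ i → ≤-trans (≤-reflexive (∑-distrib-+ (A i) (B i)))
               (≤-trans (+-mono-≤ (sum-pick _ (h c)) (sum-pick _ (h c))) (ends-weight i))) ⟩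
        sum (λ v → ⟦ W? v ⟧) * 2 + sum (λ i → 2 + X i)
          ≡⟨ cong (_ +_) (trans (∑-distrib-+ (λ _ → 2) X) (cong (_+ sum X) (sum-const s 2))) ⟩
        sum (λ v → ⟦ W? v ⟧) * 2 + (s * 2 + sum X) ∎
        where
        open ≤-Reasoning
        A B : Fin s → Fin (V G) → ℕ
        A i v = ⟦ proj₁ (ends G (μ i)) ≟ v ⟧ * h c v
        B i v = ⟦ proj₂ (ends G (μ i)) ≟ v ⟧ * h c v
        X : Fin s → ℕ
        X i = ⟦ ¬? (D? i) ⟧ * (z c (proj₁ (ends G (μ i))) + z c (proj₂ (ends G (μ i))))

    module _ {m : ℕ} (κ : Fin m → Fin n) {C : Fin m → Set} (C? : ∀ j → Dec (C j)) where

      -- Each class needs weight `2 * (n + d)`. The matching edges absorb `2 * s` and `W` at most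
      -- `2 * w`, so nearly `2 * d` per colour must come from ends of edges outside `D` joined to
      -- `U`. Summed over the colours of `C`, this cannot be supplied by edges below the threshold
      -- `θ`, and a rich edge supplies at most two per colour.
      many-rich : ∀ {w a d θ} → (∀ j → C j → NoEdgeInside U (κ j)) →
        (∀ c → n + d ≤ colourCount G col c) → s ≤ n →
        sum (λ v → ⟦ W? v ⟧) ≤ w → a ≤ sum (λ j → ⟦ C? j ⟧) → 1 ≤ a → 4 * w ≤ d → 4 * (n * θ) ≤ a * d →
        d ≤ 2 * sum (λ i → ⟦ ¬? (D? i) ×-dec rich? U? κ C? θ (μ i) ⟧)
      many-rich {w} {a} {d} {θ} noInside large s≤n W≤w a≤A 1≤a 4w≤d 4nθ≤ad = *-cancelˡ-≤ (2 * A) {{2A≢0}} final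
        where
        open ≤-Reasoning
        A g : ℕ
        A = sum (λ j → ⟦ C? j ⟧)
        g = sum (λ i → ⟦ ¬? (D? i) ×-dec rich? U? κ C? θ (μ i) ⟧)
        2A≢0 : NonZero (2 * A)
        2A≢0 = >-nonZero (≤-trans (≤-trans 1≤a a≤A) (m≤m+n A _))
        Y : Fin m → Fin s → ℕ
        Y j i = ⟦ ¬? (D? i) ⟧ * (z (κ j) (proj₁ (ends G (μ i))) + z (κ j) (proj₂ (ends G (μ i))))
        per-colour : ∀ j → ⟦ C? j ⟧ * (d * 2) ≤ ⟦ C? j ⟧ * (w * 2) + ⟦ C? j ⟧ * sum (Y j)
        per-colour j with C? j
        ... | no _ = z≤n
        -- The base weight 2 of each matching edge, at most `2 * n` in total, cancels against the
        -- `n` in the class size; only the surplus `d` remains.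
        ... | yes cj = +-cancelˡ-≤ (n * 2) _ _ (begin
          n * 2 + (d * 2 + 0)
            ≡⟨ eq₁ n d ⟩
          (n + d) * 2
            ≤⟨ *-monoˡ-≤ 2 (≤-trans (large (κ j)) (≤-reflexive (count≡sum (E G) (λ e → col e ≟ κ j)))) ⟩
          sum (λ f → ⟦ col f ≟ κ j ⟧) * 2
            ≤⟨ class-weight (κ j) (noInside j cj) ⟩
          sum (h (κ j))
            ≤⟨ total-weight (κ j) (noInside j cj) ⟩
          sum (λ v → ⟦ W? v ⟧) * 2 + (s * 2 + sum (Y j))
            ≤⟨ +-mono-≤ (*-monoˡ-≤ 2 W≤w) (+-monoˡ-≤ (sum (Y j)) (*-monoˡ-≤ 2 s≤n)) ⟩
          w * 2 + (n * 2 + sum (Y j))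
            ≡⟨ eq₂ n w (sum (Y j)) ⟩
          n * 2 + (w * 2 + 0 + (sum (Y j) + 0)) ∎)
          where
          eq₁ : ∀ n d → n * 2 + (d * 2 + 0) ≡ (n + d) * 2
          eq₁ = solve-∀
          eq₂ : ∀ n w y → w * 2 + (n * 2 + y) ≡ n * 2 + (w * 2 + 0 + (y + 0))
          eq₂ = solve-∀
        into : Fin s → ℕ
        into i = coloursInto U? κ C? (proj₁ (ends G (μ i))) + coloursInto U? κ C? (proj₂ (ends G (μ i)))
        regroup : ∀ i → sum (λ j → ⟦ C? j ⟧ * Y j i) ≡ ⟦ ¬? (D? i) ⟧ * into i
        regroup i = trans (sum-cong-≗ λ j → swap ⟦ C? j ⟧ ⟦ ¬? (D? i) ⟧ _ _)
          (trans (sym (*-distribˡ-sum ⟦ ¬? (D? i) ⟧ (λ j → p j + q j))) (cong (⟦ ¬? (D? i) ⟧ *_) (∑-distrib-+ p q)))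
          where
          p q : Fin m → ℕ
          p j = ⟦ C? j ⟧ * z (κ j) (proj₁ (ends G (μ i)))
          q j = ⟦ C? j ⟧ * z (κ j) (proj₂ (ends G (μ i)))
          swap : ∀ x y a b → x * (y * (a + b)) ≡ y * (x * a + x * b)
          swap = solve-∀
        into≤A : ∀ v → coloursInto U? κ C? v ≤ A
        into≤A v = sum-mono λ j → ≤-trans (*-monoʳ-≤ ⟦ C? j ⟧ (⟦⟧≤1 (edgeInto? U? (κ j) v))) (≤-reflexive (*-identityʳ _))
        -- A rich edge is charged every colour of `C` at both ends; any other edge contributes at
        -- most `θ` at each end.
        per-edge : ∀ i → ⟦ ¬? (D? i) ⟧ * into i ≤ ⟦ ¬? (D? i) ×-dec rich? U? κ C? θ (μ i) ⟧ * (2 * A) + 2 * θ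
        per-edge i with D? i | rich? U? κ C? θ (μ i)
        ... | yes _ | _ = z≤n
        ... | no _ | yes _ = ≤-trans (≤-reflexive (+-identityʳ _))
          (≤-trans (+-mono-≤ (into≤A _) (≤-trans (into≤A _) (m≤m+n A 0)))
          (≤-trans (m≤m+n (2 * A) 0) (m≤m+n _ (2 * θ))))
        ... | no _ | no ¬r = ≤-trans (≤-reflexive (+-identityʳ _))
          (+-mono-≤ (<⇒≤ (≰⇒> (¬r ∘ inj₁))) (≤-trans (<⇒≤ (≰⇒> (¬r ∘ inj₂))) (m≤m+n θ 0)))
        summed : A * (d * 2) ≤ A * (w * 2) + (g * (2 * A) + n * (2 * θ))
        summed = begin
          A * (d * 2)
            ≡⟨ *-distribʳ-sum (d * 2) (λ j → ⟦ C? j ⟧) ⟩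
          sum (λ j → ⟦ C? j ⟧ * (d * 2))
            ≤⟨ sum-mono per-colour ⟩
          sum (λ j → ⟦ C? j ⟧ * (w * 2) + ⟦ C? j ⟧ * sum (Y j))
            ≡⟨ ∑-distrib-+ (λ j → ⟦ C? j ⟧ * (w * 2)) (λ j → ⟦ C? j ⟧ * sum (Y j)) ⟩
          sum (λ j → ⟦ C? j ⟧ * (w * 2)) + sum (λ j → ⟦ C? j ⟧ * sum (Y j))
            ≡⟨ cong₂ _+_ (sym (*-distribʳ-sum (w * 2) (λ j → ⟦ C? j ⟧)))
                 (trans (sum-cong-≗ λ j → *-distribˡ-sum ⟦ C? j ⟧ (Y j)) (trans (∑-comm (λ j i → ⟦ C? j ⟧ * Y j i)) (sum-cong-≗ regroup))) ⟩
          A * (w * 2) + sum (λ i → ⟦ ¬? (D? i) ⟧ * into i)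
            ≤⟨ +-monoʳ-≤ _ (sum-mono per-edge) ⟩
          A * (w * 2) + sum (λ i → ⟦ ¬? (D? i) ×-dec rich? U? κ C? θ (μ i) ⟧ * (2 * A) + 2 * θ)
            ≡⟨ cong (A * (w * 2) +_) (trans (∑-distrib-+ (λ i → ⟦ ¬? (D? i) ×-dec rich? U? κ C? θ (μ i) ⟧ * (2 * A)) (λ _ → 2 * θ))
                 (cong₂ _+_ (sym (*-distribʳ-sum (2 * A) (λ i → ⟦ ¬? (D? i) ×-dec rich? U? κ C? θ (μ i) ⟧))) (sum-const s (2 * θ)))) ⟩
          A * (w * 2) + (g * (2 * A) + s * (2 * θ))
            ≤⟨ +-monoʳ-≤ (A * (w * 2)) (+-monoʳ-≤ (g * (2 * A)) (*-monoˡ-≤ (2 * θ) s≤n)) ⟩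
          A * (w * 2) + (g * (2 * A) + n * (2 * θ)) ∎
        -- After doubling, the left side is four times `A * d`; the losses `A * (4 * w)` and
        -- `4 * (n * θ)` use up one `A * d` each.
        final : 2 * A * d ≤ 2 * A * (2 * g)
        final = +-cancelˡ-≤ (2 * A * d) _ _ (begin
          2 * A * d + 2 * A * d                        ≡⟨ eq₁ A d ⟩
          2 * (A * (d * 2))                            ≤⟨ *-monoʳ-≤ 2 summed ⟩
          2 * (A * (w * 2) + (g * (2 * A) + n * (2 * θ))) ≡⟨ eq₂ A w g n θ ⟩
          A * (4 * w) + 4 * (n * θ) + 2 * A * (2 * g)  ≤⟨ +-monoˡ-≤ (2 * A * (2 * g)) (+-mono-≤ (*-monoʳ-≤ A 4w≤d)
                                                            (≤-trans 4nθ≤ad (*-monoˡ-≤ d a≤A))) ⟩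
          A * d + A * d + 2 * A * (2 * g)              ≡⟨ eq₃ A d g ⟩
          2 * A * d + 2 * A * (2 * g) ∎)
          where
          eq₁ : ∀ A d → 2 * A * d + 2 * A * d ≡ 2 * (A * (d * 2))
          eq₁ = solve-∀
          eq₂ : ∀ A w g n θ → 2 * (A * (w * 2) + (g * (2 * A) + n * (2 * θ))) ≡ A * (4 * w) + 4 * (n * θ) + 2 * A * (2 * g)
          eq₂ = solve-∀
          eq₃ : ∀ A d g → A * d + A * d + 2 * A * (2 * g) ≡ 2 * A * d + 2 * A * (2 * g)
          eq₃ = solve-∀

-- Exchanging edges

-- The number of switches needed to carry out the release of an edge of the given level.
cost : ℕ → ℕ
cost zero = 1
cost (suc j) = suc (cost j + cost j)

cost>0 : ∀ j → 1 ≤ cost j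
cost>0 zero = s≤s z≤n
cost>0 (suc j) = s≤s z≤n

cost-mono : ∀ j → cost j ≤ cost (suc j)
cost-mono j = ≤-trans (m≤m+n _ _) (n≤1+n _)

module Switching (G : MultiGraph) {n : ℕ} (col : Fin (E G) → Fin n) (proper : ProperColouring G n col) where
  open Counting G col proper

  RainbowMatching : List (Fin (E G)) → Set
  RainbowMatching = AllPairs (λ e f → ¬ ShareEndpoint G e f × col e ≢ col f)

  module Fixed {s : ℕ} (μ : Fin s → Fin (E G))
    (disjoint : ∀ {i j v} → Incident G (μ i) v → Incident G (μ j) v → i ≡ j)
    (rainbow : ∀ {i j} → col (μ i) ≡ col (μ j) → i ≡ j) where

    Conflict : Fin s → Fin (E G) → Set
    Conflict i f = (∃ λ v → Incident G (μ i) v × Incident G f v) ⊎ col (μ i) ≡ col f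

    Covered : Fin (V G) → Set
    Covered v = ∃ λ i → Incident G (μ i) v

    abstract
      covered? : ∀ v → Dec (Covered v)
      covered? v = Fin.any? λ i → incident? (μ i) v

    tail head : Bool → Fin s → Fin (V G)
    tail true i = proj₁ (ends G (μ i))
    tail false i = proj₂ (ends G (μ i))
    head b i = tail (not b) i

    tail-joins-head : ∀ b i → Joins G (μ i) (tail b i) (head b i)
    tail-joins-head true i = inj₁ (refl , refl)
    tail-joins-head false i = inj₂ (refl , refl)

    tail-incident : ∀ b i → Incident G (μ i) (tail b i)
    tail-incident b i = joins-incident (tail-joins-head b i)

    head-incident : ∀ b i → Incident G (μ i) (head b i)
    head-incident b i = joins-incident (joins-sym (tail-joins-head b i))

    Labelling : Set
    Labelling = Fin s → Maybe Bool

    Labelled : Labelling → Fin s → Set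
    Labelled m i = ∃ λ b → m i ≡ just b

    abstract
      labelled? : ∀ m i → Dec (Labelled m i)
      labelled? m i with m i
      ... | just b = yes (b , refl)
      ... | nothing = no λ ()

    -- `Z` stands for the colours already spent by the exchange in progress, which the rerouting
    -- edge has to avoid.
    Reroute : (Fin (V G) → Maybe (Fin s)) → Bool → Fin s → List (Fin n) → Set
    Reroute owner b i Z = ∃ λ f → ∃ λ w →
      Joins G f (tail b i) w × owner w ≡ just i × (∀ k → col (μ k) ≢ col f) × col f ∉ Z

    -- Levels of releasable matching edges

    module Levels (m₀ : Labelling) (owner : Fin (V G) → Maybe (Fin s)) (θ : ℕ) where

      -- Owned vertices are not free, so switches at positive levels leave the reserves of the seed
      -- edges untouched.
      Free : Labelling → Fin (V G) → Set
      Free m v = (¬ Covered v × owner v ≡ nothing) ⊎ ∃ λ i → ∃ λ b → m i ≡ just b × head b i ≡ v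

      abstract
        free? : ∀ m v → Dec (Free m v)
        free? m v = (¬? (covered? v) ×-dec Maybe.≡-dec _≟_ (owner v) nothing) ⊎-dec Fin.any? headed?
          where
          headed? : ∀ i → Dec (∃ λ b → m i ≡ just b × head b i ≡ v)
          headed? i with m i
          ... | nothing = no λ { (_ , () , _) }
          ... | just b = map′ (λ e → b , refl , e) (λ { (_ , refl , e) → e }) (head b i ≟ v)

      freeColours : Labelling → Fin (V G) → ℕ
      freeColours m = coloursInto (free? m) (col ∘ μ) (labelled? m)

      -- An index labelled b can release its colour and the vertex head b by rerouting tail b.
      next : Labelling → Labelling
      next m i with m i | θ ≤? freeColours m (tail true i) | θ ≤? freeColours m (tail false i)
      ... | just b | _ | _ = just b
      ... | nothing | yes _ | _ = just true
      ... | nothing | no _ | yes _ = just false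
      ... | nothing | no _ | no _ = nothing

      next-inv : ∀ {m i b} → next m i ≡ just b → m i ≡ just b ⊎ θ ≤ freeColours m (tail b i)
      next-inv {m} {i} eq with m i | θ ≤? freeColours m (tail true i) | θ ≤? freeColours m (tail false i)
      next-inv refl | just b | _ | _ = inj₁ refl
      next-inv refl | nothing | yes p | _ = inj₂ p
      next-inv refl | nothing | no _ | yes p = inj₂ p

      next-keeps : ∀ {m i b} → m i ≡ just b → next m i ≡ just b
      next-keeps {m} {i} eq with m i | θ ≤? freeColours m (tail true i) | θ ≤? freeColours m (tail false i)
      next-keeps eq | just b | _ | _ = eq

      next-rich : ∀ {m i} → Rich (free? m) (col ∘ μ) (labelled? m) θ (μ i) → Labelled (next m) i
      next-rich {m} {i} r with m i | θ ≤? freeColours m (tail true i) | θ ≤? freeColours m (tail false i)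
      ... | just b | _ | _ = b , refl
      ... | nothing | yes _ | _ = true , refl
      ... | nothing | no _ | yes _ = false , refl
      next-rich (inj₁ p) | nothing | no ¬p | no _ = ⊥-elim (¬p p)
      next-rich (inj₂ p) | nothing | no _ | no ¬p = ⊥-elim (¬p p)

      level : ℕ → Labelling
      level zero = m₀
      level (suc j) = next (level j)

      -- `lev` is some level at which the label is present, not necessarily the first; `relevel`
      -- lowers it when possible.
      record Task : Set where
        constructor task
        field
          index : Fin s
          lev : ℕ
          label : Bool
          labelled : level lev index ≡ just label
      open Task

      indices : List Task → List (Fin s)
      indices = map index

      tailOf headOf : Task → Fin (V G)
      tailOf t = tail (label t) (index t)
      headOf t = head (label t) (index t)

      costs : List Task → ℕ
      costs [] = 0
      costs (t ∷ Q) = cost (lev t) + costs Q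

      length≤costs : ∀ Q → length Q ≤ costs Q
      length≤costs [] = z≤n
      length≤costs (t ∷ Q) = +-mono-≤ (cost>0 (lev t)) (length≤costs Q)

      costs-++ : ∀ Q R → costs (Q ++ R) ≡ costs Q + costs R
      costs-++ [] R = refl
      costs-++ (t ∷ Q) R = trans (cong (cost (lev t) +_) (costs-++ Q R)) (sym (+-assoc (cost (lev t)) _ _))

      module Search (owner-outside : ∀ {v i} → owner v ≡ just i → ¬ Covered v) where

        owner-covered : ∀ {v} → Covered v → owner v ≡ nothing
        owner-covered {v} cv with owner v in eq
        ... | nothing = refl
        ... | just i = ⊥-elim (owner-outside eq cv)

        free-unowned : ∀ {m v} → Free m v → owner v ≡ nothing
        free-unowned (inj₁ (_ , e)) = e
        free-unowned (inj₂ (i , b , _ , refl)) = owner-covered (i , head-incident b i)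

        tail≢head : ∀ b i → tail b i ≢ head b i
        tail≢head b i = joins-≢ (tail-joins-head b i)

        -- A covered vertex can be free only as the head of the one matching edge through it, and
        -- that edge has a single label.
        tail-not-free : ∀ {m i b} → m i ≡ just b → ¬ Free m (tail b i)
        tail-not-free {i = i} {b} eq (inj₁ (¬c , _)) = ¬c (i , tail-incident b i)
        tail-not-free {i = i} {b} eq (inj₂ (k , b′ , eq′ , h))
          with disjoint {k} {i} (subst (Incident G (μ k)) h (head-incident b′ k)) (tail-incident b i)
        ... | refl with trans (sym eq) eq′
        ... | refl = tail≢head b i (sym h)

        -- Y is to be switched into the matching in place of the edges indexed by P; the indices of Q
        -- still conflict with Y, but only through their heads and colours.
        record State (Y : List (Fin (E G))) (P : List (Fin s)) (Q : List Task) : Set where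
          field
            isRainbow : RainbowMatching Y
            conflicts : ∀ {i f} → f ∈ Y → Conflict i f → i ∈ P ⊎ i ∈ indices Q
            tails     : ∀ {t f} → t ∈ Q → f ∈ Y → ¬ Incident G f (tailOf t)
            distinct  : AllPairs _≢_ (indices Q)
            fresh     : ∀ {i} → i ∈ indices Q → i ∉ P
            reserved  : ∀ {f v i} → f ∈ Y → Incident G f v → owner v ≡ just i → i ∈ P
        open State

        empty : State [] [] []
        empty .isRainbow = []
        empty .conflicts ()
        empty .tails ()
        empty .distinct = []
        empty .fresh ()
        empty .reserved ()

        -- The edge is now to be removed altogether, so its tail is no longer protected and the next
        -- edge of `Y` may be placed there.
        retire : ∀ {Y P t Q} → State Y P (t ∷ Q) → State Y (index t ∷ P) Q
        retire st .isRainbow = isRainbow st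
        retire st .conflicts f∈ c with conflicts st f∈ c
        ... | inj₁ p = inj₁ (there p)
        ... | inj₂ (here e) = inj₁ (here e)
        ... | inj₂ (there q) = inj₂ q
        retire st .tails t∈ = tails st (there t∈)
        retire st .distinct = AllPairs.tail (distinct st)
        retire st .fresh i∈ (here refl) = All.lookup (AllPairs.head (distinct st)) i∈ refl
        retire st .fresh i∈ (there p) = fresh st (there i∈) p
        retire st .reserved f∈ inc eq = there (reserved st f∈ inc eq)

        relevel : ∀ {Y P i b j j′ Q} {e : level j i ≡ just b} {e′ : level j′ i ≡ just b} →
          State Y P (task i j b e ∷ Q) → State Y P (task i j′ b e′ ∷ Q)
        relevel st .isRainbow = isRainbow st
        relevel st .conflicts = conflicts st
        relevel st .tails (here refl) = tails st (here refl)
        relevel st .tails (there t∈) = tails st (there t∈)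
        relevel st .distinct = distinct st
        relevel st .fresh = fresh st
        relevel st .reserved = reserved st

        add : ∀ {Y P Q} → State Y P Q → ∀ f N →
          (∀ {g v} → g ∈ Y → Incident G f v → ¬ Incident G g v) →
          (∀ {g} → g ∈ Y → col f ≢ col g) →
          (∀ {i} → Conflict i f → i ∈ P ⊎ i ∈ indices N) →
          AllPairs _≢_ (indices N) →
          (∀ {i} → i ∈ indices N → i ∉ P × i ∉ indices Q) →
          (∀ {t} → t ∈ N ⊎ t ∈ Q → ¬ Incident G f (tailOf t)) →
          (∀ {v i} → Incident G f v → owner v ≡ just i → i ∈ P) →
          State (f ∷ Y) P (N ++ Q)
        add {Y} {P} {Q} st f N apart newColour conf dist new newTails priv = result
          where
          ∈-new : ∀ {i} → i ∈ indices N → i ∈ indices (N ++ Q)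
          ∈-new i∈ rewrite List.map-++ index N Q = ∈-++⁺ˡ i∈
          ∈-old : ∀ {i} → i ∈ indices Q → i ∈ indices (N ++ Q)
          ∈-old i∈ rewrite List.map-++ index N Q = ∈-++⁺ʳ (indices N) i∈
          split : ∀ {i} → i ∈ indices (N ++ Q) → i ∈ indices N ⊎ i ∈ indices Q
          split i∈ rewrite List.map-++ index N Q = ∈-++⁻ (indices N) i∈
          result : State (f ∷ Y) P (N ++ Q)
          result .isRainbow = All.tabulate
            (λ g∈ → (λ sh → let (_ , p , q) = shared sh in apart g∈ p q) , newColour g∈) ∷ isRainbow st
          result .conflicts (here refl) c = Sum.map₂ ∈-new (conf c)
          result .conflicts (there f∈) c = Sum.map₂ ∈-old (conflicts st f∈ c)
          result .tails t∈ (here refl) = newTails (∈-++⁻ N t∈)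
          result .tails {t} t∈ (there g∈) inc with ∈-++⁻ N t∈
          ... | inj₂ t∈Q = tails st t∈Q g∈ inc
          -- An older edge at the tail of a new task would conflict with that index, which would
          -- then already belong to `P` or `Q`.
          ... | inj₁ t∈N with new (∈-map⁺ index t∈N)
                            | conflicts st g∈ (inj₁ (tailOf t , tail-incident (label t) (index t) , inc))
          ... | ∉P , _ | inj₁ p = ∉P p
          ... | _ , ∉Q | inj₂ q = ∉Q q
          result .distinct rewrite List.map-++ index N Q = AllPairs.++⁺ dist (distinct st)
            (All.tabulate λ i∈ → All.tabulate λ k∈ e → proj₂ (new i∈) (subst (_∈ indices Q) (sym e) k∈))
          result .fresh i∈ with split i∈
          ... | inj₁ p = proj₁ (new p)
          ... | inj₂ q = fresh st q
          result .reserved (here refl) inc eq = priv inc eq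
          result .reserved (there f∈) inc eq = reserved st f∈ inc eq

        -- The work that makes a free vertex usable: none for a vertex outside the matching,
        -- otherwise the release of the one matching edge whose head it is.
        record VertexTasks (j : ℕ) (u : Fin (V G)) : Set where
          field
            tasks : List Task
            complete : ∀ {k} → Incident G (μ k) u → k ∈ indices tasks
            heads : ∀ {t} → t ∈ tasks → headOf t ≡ u
            levels : ∀ {t} → t ∈ tasks → lev t ≡ j
            unique : AllPairs _≢_ (indices tasks)
            cheap : costs tasks ≤ cost j

        vertexTasks : ∀ j {u} → Free (level j) u → VertexTasks j u
        vertexTasks j (inj₁ (¬c , _)) = record
          { tasks = [] ; complete = λ inc → ⊥-elim (¬c (_ , inc)) ; heads = λ () ; levels = λ ()
          ; unique = [] ; cheap = z≤n }
        vertexTasks j (inj₂ (i , b , eq , refl)) = record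
          { tasks = task i j b eq ∷ []
          ; complete = λ inc → here (disjoint inc (head-incident b i))
          ; heads = λ { (here refl) → refl }
          ; levels = λ { (here refl) → refl }
          ; unique = [] ∷ []
          ; cheap = ≤-reflexive (+-identityʳ _) }

        heads-incident : ∀ {t u} → headOf t ≡ u → Incident G (μ (index t)) u
        heads-incident {t} refl = head-incident (label t) (index t)

        -- The other end of an edge f of the colour of μ i at the head of i would be the tail of i.
        own-colour : ∀ {f x u i b} → Joins G f x u → col f ≡ col (μ i) → head b i ≡ u → x ≡ tail b i
        own-colour {f} {x} {u} {i} {b} jn ce refl
          with monochromatic-unique ce (joins-incident (joins-sym jn)) (head-incident b i)
        ... | refl with incident-joins (tail-joins-head b i) (joins-incident jn)
        ... | inj₁ e = e
        ... | inj₂ e = ⊥-elim (joins-≢ jn e)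

        endpoints : List (Fin (E G)) → List (Fin (V G))
        endpoints [] = []
        endpoints (f ∷ F) = proj₁ (ends G f) ∷ proj₂ (ends G f) ∷ endpoints F

        ∈-endpoints : ∀ {F f v} → f ∈ F → Incident G f v → v ∈ endpoints F
        ∈-endpoints (here refl) (inj₁ e) = here (sym e)
        ∈-endpoints (here refl) (inj₂ e) = there (here (sym e))
        ∈-endpoints (there f∈) inc = there (there (∈-endpoints f∈ inc))

        length-endpoints : ∀ F → length (endpoints F) ≡ length F * 2
        length-endpoints [] = refl
        length-endpoints (f ∷ F) = cong (λ k → suc (suc k)) (length-endpoints F)

        -- `B` is the budget of switches for one whole exchange, and `T` bounds the edges and
        -- indices in play at any moment. In `θ-large` the term `T` pays for forbidden indices;
        -- `(T + T) * 2` counts the endpoints of edges in play, each of which blocks at most `δ`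
        -- colours.
        module Run (T B δ : ℕ) (B<T : suc B < T)
          (multiplicities : ∀ u w → multiplicity G u w ≤ δ)
          (θ-large : T + (T + T) * 2 * δ < θ)
          (options : ∀ {i b} → m₀ i ≡ just b → ∀ Z → length Z < T → Reroute owner b i Z)
          (maximal : ∀ {Y P} → RainbowMatching Y → (∀ {i f} → f ∈ Y → Conflict i f → i ∈ P) →
            ¬ (length P < length Y)) where

          -- Between `x` and a forbidden vertex there are at most `δ` edges, and each of their
          -- colours belongs to at most one matching edge. So fewer than `θ` of the available
          -- indices are spoilt.
          choose : ∀ {m x} (A : List (Fin s)) (X : List (Fin (V G))) → θ ≤ freeColours m x →
            length A + length X * δ < θ →
            ∃ λ i → ∃ λ b → ∃ λ f → ∃ λ u →
              m i ≡ just b × Joins G f x u × col f ≡ col (μ i) × Free m u × i ∉ A × u ∉ X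
          choose {m} {x} A X many few = extract (exceeds {f = good} {g = bad} (<-≤-trans bad<θ many))
            where
            open ≤-Reasoning
            Parallel : Fin (V G) → Fin s → Set
            Parallel u i = ∃ λ f → Joins G f x u × col f ≡ col (μ i)
            parallel? : ∀ u i → Dec (Parallel u i)
            parallel? u i = Fin.any? λ f → joins? G x u f ×-dec (col f ≟ col (μ i))
            hit? : ∀ i → Dec (Any (λ u → Parallel u i) X)
            hit? i = Any.any? (λ u → parallel? u i) X
            good bad : Fin s → ℕ
            good i = ⟦ labelled? m i ⟧ * ⟦ edgeInto? (free? m) (col (μ i)) x ⟧
            bad i = ⟦ i ∈? A ⟧ + ⟦ hit? i ⟧
            parallel-bound : ∀ u → sum (λ i → ⟦ parallel? u i ⟧) ≤ δ
            parallel-bound u = begin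
              sum (λ i → ⟦ parallel? u i ⟧)
                ≤⟨ image-bound (joins? G x u) (λ f i → col f ≟ col (μ i))
                     (λ f p q → rainbow (trans (sym p) q)) (parallel? u) ⟩
              sum (λ f → ⟦ joins? G x u f ⟧)
                ≡⟨ sym (count≡sum (E G) (joins? G x u)) ⟩
              multiplicity G x u
                ≤⟨ multiplicities x u ⟩
              δ ∎
            bad<θ : sum bad < θ
            bad<θ = begin-strict
              sum bad
                ≡⟨ ∑-distrib-+ (λ i → ⟦ i ∈? A ⟧) (λ i → ⟦ hit? i ⟧) ⟩
              sum (λ i → ⟦ i ∈? A ⟧) + sum (λ i → ⟦ hit? i ⟧)
                ≤⟨ +-mono-≤ (∈-bound A) (list-bound parallel? δ parallel-bound X hit?) ⟩
              length A + length X * δ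
                <⟨ few ⟩
              θ ∎
            extract : (∃ λ i → bad i < good i) → ∃ λ i → ∃ λ b → ∃ λ f → ∃ λ u →
              m i ≡ just b × Joins G f x u × col f ≡ col (μ i) × Free m u × i ∉ A × u ∉ X
            extract (i , lt)
              with ⟦⟧-exceeds (labelled? m i ×-dec edgeInto? (free? m) (col (μ i)) x)
                     (subst (bad i <_) (sym (⟦⟧-× (labelled? m i) (edgeInto? (free? m) (col (μ i)) x))) lt)
            ... | ((b , eq) , f , u , jn , ce , fr) , bad≡0 =
              i , b , f , u , eq , jn , ce , fr ,
              ⟦⟧≡0 (i ∈? A) (m+n≡0⇒m≡0 _ bad≡0) ,
              λ u∈ → ⟦⟧≡0 (hit? i) (m+n≡0⇒n≡0 ⟦ i ∈? A ⟧ bad≡0) (Any.map (λ { refl → f , jn , ce }) u∈)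

          seed-step : ∀ {Y P i b eq Q} → State Y P (task i zero b eq ∷ Q) →
            ∀ {f w} → Joins G f (tail b i) w → owner w ≡ just i → (∀ k → col (μ k) ≢ col f) → col f ∉ map col Y →
            State (f ∷ Y) (i ∷ P) Q
          seed-step {Y} {P} {i} {b} {eq} {Q} st {f} {w} jn ow unused new =
            add (retire st) f [] apart (λ g∈ e → new (subst (_∈ map col Y) (sym e) (∈-map⁺ col g∈)))
              conf [] (λ ()) newTails priv
            where
            apart : ∀ {g v} → g ∈ Y → Incident G f v → ¬ Incident G g v
            apart g∈ p q with incident-joins jn p
            ... | inj₁ refl = tails st (here refl) g∈ q
            ... | inj₂ refl = fresh st (here refl) (reserved st g∈ q ow)
            conf : ∀ {k} → Conflict k f → k ∈ i ∷ P ⊎ k ∈ []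
            conf (inj₂ e) = ⊥-elim (unused _ e)
            conf (inj₁ (v , p , q)) with incident-joins jn q
            ... | inj₁ refl = inj₁ (here (disjoint p (tail-incident b i)))
            ... | inj₂ refl = ⊥-elim (owner-outside ow (_ , p))
            newTails : ∀ {t′} → t′ ∈ [] ⊎ t′ ∈ Q → ¬ Incident G f (tailOf t′)
            newTails {t′} (inj₂ t∈) p with incident-joins jn p
            ... | inj₂ e = owner-outside ow (_ , subst (Incident G (μ (index t′))) e (tail-incident (label t′) (index t′)))
            ... | inj₁ e = All.lookup (AllPairs.head (distinct st)) (∈-map⁺ index t∈)
                    (disjoint (tail-incident b i) (subst (Incident G (μ (index t′))) e (tail-incident (label t′) (index t′))))
            priv : ∀ {v k} → Incident G f v → owner v ≡ just k → k ∈ i ∷ P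
            priv p o with incident-joins jn p
            ... | inj₁ refl = ⊥-elim (owner-outside o (_ , tail-incident b i))
            ... | inj₂ refl with trans (sym o) ow
            ... | refl = here refl

          -- The new edge at the tail of `i` occupies the colour of `i′` and the vertex `u`. These
          -- create at most two tasks of level `j`: release `i′` for its colour, and release the
          -- edge with head `u`, if there is one.
          switch-step : ∀ {Y P i j b eq Q} → State Y P (task i (suc j) b eq ∷ Q) →
            ∀ {i′ b′ f u} (eq′ : level j i′ ≡ just b′) → Joins G f (tail b i) u → col f ≡ col (μ i′) → Free (level j) u →
            i′ ∉ P ++ i ∷ indices Q → u ∉ endpoints (Y ++ map μ (P ++ i ∷ indices Q)) →
            ∃ λ N → State (f ∷ Y) (i ∷ P) N × costs N ≤ cost j + cost j + costs Q
          switch-step {Y} {P} {i} {j} {b} {eq} {Q} st {i′} {b′} {f} {u} eq′ jn ce fr i′∉A u∉X =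
            (t′ ∷ N) ++ Q ,
            add (retire st) f (t′ ∷ N) apart newColour conf
              (All.tabulate (λ {k} k∈ e → t′∉N (subst (_∈ indices N) (sym e) k∈)) ∷ unique)
              new-tasks newTails (λ p o → priv p o) ,
            ≤-trans (≤-reflexive (costs-++ (t′ ∷ N) Q)) (+-monoˡ-≤ (costs Q) (+-monoʳ-≤ (cost j) cheap))
            where
            open VertexTasks (vertexTasks j fr) renaming (tasks to N)
            A : List (Fin s)
            A = P ++ i ∷ indices Q
            t′ : Task
            t′ = task i′ j b′ eq′
            i∈A : i ∈ A
            i∈A = ∈-++⁺ʳ P (here refl)
            Q∈A : ∀ {k} → k ∈ indices Q → k ∈ A
            Q∈A k∈ = ∈-++⁺ʳ P (there k∈)
            untouched-Y : ∀ {g} → g ∈ Y → ¬ Incident G g u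
            untouched-Y g∈ p = u∉X (∈-endpoints (∈-++⁺ˡ g∈) p)
            untouched-A : ∀ {k} → k ∈ A → ¬ Incident G (μ k) u
            untouched-A k∈ p = u∉X (∈-endpoints (∈-++⁺ʳ Y (∈-map⁺ μ k∈)) p)
            heads-inc : ∀ {k} → k ∈ indices N → Incident G (μ k) u
            heads-inc k∈ with ∈-map⁻ index k∈
            ... | t″ , t∈ , refl = heads-incident {t″} (heads t∈)
            N∉A : ∀ {k} → k ∈ indices N → k ∉ A
            N∉A k∈ k∈A = untouched-A k∈A (heads-inc k∈)
            new : ∀ {k} → k ∉ A → k ∉ i ∷ P × k ∉ indices Q
            new k∉ = (λ { (here refl) → k∉ i∈A ; (there p) → k∉ (∈-++⁺ˡ p) }) , λ q → k∉ (Q∈A q)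
            apart : ∀ {g v} → g ∈ Y → Incident G f v → ¬ Incident G g v
            apart g∈ p q with incident-joins jn p
            ... | inj₁ refl = tails st (here refl) g∈ q
            ... | inj₂ refl = untouched-Y g∈ q
            newColour : ∀ {g} → g ∈ Y → col f ≢ col g
            newColour g∈ e with conflicts st g∈ (inj₂ (trans (sym ce) e))
            ... | inj₁ p = i′∉A (∈-++⁺ˡ p)
            ... | inj₂ q = i′∉A (∈-++⁺ʳ P q)
            conf : ∀ {k} → Conflict k f → k ∈ i ∷ P ⊎ k ∈ indices (t′ ∷ N)
            conf (inj₂ e) = inj₂ (here (rainbow (trans e ce)))
            conf (inj₁ (v , p , q)) with incident-joins jn q
            ... | inj₁ refl = inj₁ (here (disjoint p (tail-incident b i)))
            ... | inj₂ refl = inj₂ (there (complete p))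
            not-i : ∀ {k} → k ∉ A → ∀ c → tail c k ≢ tail b i
            not-i {k} k∉ c e with disjoint (tail-incident b i) (subst (Incident G (μ k)) e (tail-incident c k))
            ... | refl = k∉ i∈A
            -- If `u` were the head of `i′`, properness at `u` would make `f` equal to `μ i′`; but
            -- `f` passes through the tail of `i`, so `i′` would be `i`.
            t′∉N : i′ ∉ indices N
            t′∉N i′∈ with monochromatic-unique ce (joins-incident (joins-sym jn)) (heads-inc i′∈)
            ... | refl with disjoint (joins-incident jn) (tail-incident b i)
            ... | refl = i′∉A i∈A
            newTails : ∀ {t″} → t″ ∈ t′ ∷ N ⊎ t″ ∈ Q → ¬ Incident G f (tailOf t″)
            newTails {t″} t∈ p with incident-joins jn p
            newTails (inj₁ (here refl)) p | inj₁ e = not-i i′∉A b′ e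
            newTails (inj₁ (here refl)) p | inj₂ e = tail-not-free eq′ (subst (Free (level j)) (sym e) fr)
            newTails {t″} (inj₁ (there t∈)) p | inj₁ e = not-i (N∉A (∈-map⁺ index t∈)) (label t″) e
            newTails {t″} (inj₁ (there t∈)) p | inj₂ e = tail≢head (label t″) (index t″) (trans e (sym (heads t∈)))
            newTails {t″} (inj₂ t∈) p | inj₁ e = All.lookup (AllPairs.head (distinct st)) (∈-map⁺ index t∈)
              (disjoint (tail-incident b i) (subst (Incident G (μ (index t″))) e (tail-incident (label t″) (index t″))))
            newTails {t″} (inj₂ t∈) p | inj₂ e = untouched-A (Q∈A (∈-map⁺ index t∈))
              (subst (Incident G (μ (index t″))) e (tail-incident (label t″) (index t″)))
            priv : ∀ {v k} → Incident G f v → owner v ≡ just k → k ∈ i ∷ P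
            priv p o with incident-joins jn p
            ... | inj₁ refl = ⊥-elim (owner-outside o (_ , tail-incident b i))
            ... | inj₂ refl with trans (sym o) (free-unowned {level j} fr)
            ... | ()
            new-tasks : ∀ {k} → k ∈ indices (t′ ∷ N) → k ∉ i ∷ P × k ∉ indices Q
            new-tasks (here refl) = new i′∉A
            new-tasks (there k∈) = new (N∉A k∈)

          excluded : ∀ (Y : List (Fin (E G))) A → length Y ≤ T → length A ≤ T →
            length A + length (endpoints (Y ++ map μ A)) * δ < θ
          excluded Y A Y≤T A≤T = ≤-<-trans (+-mono-≤ A≤T (*-monoˡ-≤ δ (begin
            length (endpoints (Y ++ map μ A)) ≡⟨ length-endpoints (Y ++ map μ A) ⟩
            length (Y ++ map μ A) * 2         ≡⟨ cong (_* 2) (List.length-++ Y) ⟩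
            (length Y + length (map μ A)) * 2 ≡⟨ cong (λ k → (length Y + k) * 2) (List.length-map μ A) ⟩
            (length Y + length A) * 2         ≤⟨ *-monoˡ-≤ 2 (+-mono-≤ Y≤T A≤T) ⟩
            (T + T) * 2 ∎))) θ-large
            where open ≤-Reasoning

          -- Each switch adds one edge to `Y` and one index to `P`, so `Y` stays one ahead, and it
          -- lowers the outstanding cost by at least one, so the budget `B` is respected. Once no
          -- task is left, `Y` conflicts only with `P`, contrary to maximality.
          run : ∀ fuel {Y P} Q → State Y P Q → length Y ≡ suc (length P) →
            length P + costs Q ≤ B → costs Q ≤ fuel → ⊥
          run fuel [] st len _ _ =
            maximal (isRainbow st) (λ f∈ c → [ id , (λ ()) ]′ (conflicts st f∈ c)) (≤-reflexive (sym len))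
          run zero (t ∷ Q) st len bound fu = <⇒≱ (cost>0 (lev t)) (≤-trans (m≤m+n _ _) fu)
          run (suc fuel) {Y} {P} (task i zero b eq ∷ Q) st len bound (s≤s fu) =
            let (f , w , jn , ow , unused , new) = options eq (map col Y) (≤-<-trans (≤-trans
                  (≤-reflexive (trans (List.length-map col Y) len)) (s≤s (m+n≤o⇒m≤o (length P) bound))) B<T)
            in run fuel Q (seed-step st jn ow unused new) (cong suc len) (≤-trans (≤-reflexive (sym (+-suc (length P) _))) bound) fu
          run (suc fuel) {Y} {P} (task i (suc j) b eq ∷ Q) st len bound fu = continue (next-inv eq)
            where
            open ≤-Reasoning
            A : List (Fin s)
            A = P ++ i ∷ indices Q
            A≤T : length A ≤ T
            A≤T = begin
              length A                             ≡⟨ List.length-++ P ⟩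
              length P + suc (length (indices Q))  ≡⟨ cong (λ k → length P + suc k) (List.length-map index Q) ⟩
              length P + suc (length Q)            ≤⟨ +-monoʳ-≤ (length P) (s≤s (≤-trans (length≤costs Q) (m≤n+m _ (cost j + cost j)))) ⟩
              length P + (cost (suc j) + costs Q)  ≤⟨ bound ⟩
              B                                    ≤⟨ <⇒≤ (<⇒≤ B<T) ⟩
              T ∎
            Y≤T : length Y ≤ T
            Y≤T = begin
              length Y          ≡⟨ len ⟩
              suc (length P)    ≤⟨ s≤s (m+n≤o⇒m≤o (length P) bound) ⟩
              suc B             ≤⟨ <⇒≤ B<T ⟩
              T ∎
            cheaper : cost j + costs Q < cost (suc j) + costs Q
            cheaper = s≤s (+-monoˡ-≤ (costs Q) (m≤m+n (cost j) (cost j)))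
            switch : (∃ λ i′ → ∃ λ b′ → ∃ λ f → ∃ λ u → level j i′ ≡ just b′ × Joins G f (tail b i) u ×
              col f ≡ col (μ i′) × Free (level j) u × i′ ∉ A × u ∉ endpoints (Y ++ map μ A)) → ⊥
            switch (_ , _ , f , _ , eq′ , jn , ce , fr , i′∉ , u∉) =
              let (N , st′ , le) = switch-step st eq′ jn ce fr i′∉ u∉
              in run fuel N st′ (cong suc len)
                   (≤-trans (≤-reflexive (sym (+-suc (length P) _))) (≤-trans (+-monoʳ-≤ (length P) (s≤s le)) bound))
                   (≤-pred (≤-trans (s≤s le) fu))
            continue : level j i ≡ just b ⊎ θ ≤ freeColours (level j) (tail b i) → ⊥
            -- The label was already present one level lower, so the task can be carried out more
            -- cheaply there.
            continue (inj₁ eq′) = run fuel (task i j b eq′ ∷ Q) (relevel st) len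
              (≤-trans (+-monoʳ-≤ (length P) (<⇒≤ cheaper)) bound) (≤-pred (≤-trans cheaper fu))
            continue (inj₂ many) = switch (choose A (endpoints (Y ++ map μ A)) many (excluded Y A Y≤T A≤T))

          -- Start an exchange from the offending edge alone. It requires the release of the colour
          -- of `i` and of its two ends, hence at most three tasks of level `j`; `run` then enlarges
          -- the matching.
          no-edge-inside : ∀ j → cost j + (cost j + cost j) ≤ B → ∀ i → Labelled (level j) i →
            NoEdgeInside (Free (level j)) (col (μ i))
          no-edge-inside j small i (b , eq) f ce (fru , frv) =
            run (costs (N ++ [])) (N ++ [])
              (add empty f N (λ ()) (λ ()) conf N-unique (λ _ → (λ ()) , (λ ())) newTails priv)
              refl N-cheap ≤-refl
            where
            u v : Fin (V G)
            u = proj₁ (ends G f)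
            v = proj₂ (ends G f)
            jn : Joins G f u v
            jn = inj₁ (refl , refl)
            open VertexTasks (vertexTasks j fru) renaming (tasks to Nu; complete to complete-u; heads to heads-u; unique to unique-u; cheap to cheap-u)
            open VertexTasks (vertexTasks j frv) renaming (tasks to Nv; complete to complete-v; heads to heads-v; unique to unique-v; cheap to cheap-v)
            t₀ : Task
            t₀ = task i j b eq
            N : List Task
            N = t₀ ∷ Nu ++ Nv
            N-cheap : costs (N ++ []) ≤ B
            N-cheap = ≤-trans (≤-reflexive (trans (costs-++ N []) (trans (+-identityʳ _) (cong (cost j +_) (costs-++ Nu Nv)))))
              (≤-trans (+-monoʳ-≤ (cost j) (+-mono-≤ cheap-u cheap-v)) small)
            conf : ∀ {k} → Conflict k f → k ∈ [] ⊎ k ∈ indices N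
            conf (inj₂ e) = inj₂ (here (rainbow (trans e ce)))
            conf (inj₁ (x , p , inj₁ refl)) = inj₂ (there (subst (_ ∈_) (sym (List.map-++ index Nu Nv)) (∈-++⁺ˡ (complete-u p))))
            conf (inj₁ (x , p , inj₂ refl)) = inj₂ (there (subst (_ ∈_) (sym (List.map-++ index Nu Nv)) (∈-++⁺ʳ (indices Nu) (complete-v p))))
            -- Were the edge owning the colour also the one with head `y`, then `own-colour` would
            -- make `x` its tail, and a tail is not free.
            i∉ : ∀ {x y} → Joins G f x y → Free (level j) x → ∀ t → headOf t ≡ y → level j (index t) ≡ just (label t) → i ≢ index t
            i∉ jn′ fr t h lb refl = tail-not-free {b = label t} lb (subst (Free (level j)) (own-colour {b = label t} jn′ ce h) fr)
            u≠v : ∀ t t′ → headOf t ≡ u → headOf t′ ≡ v → level j (index t) ≡ just (label t) →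
              level j (index t′) ≡ just (label t′) → index t ≢ index t′
            u≠v t t′ h h′ lb lb′ refl with trans (sym lb) lb′
            ... | refl = joins-≢ jn (trans (sym h) h′)
            at-j : ∀ t → lev t ≡ j → level j (index t) ≡ just (label t)
            at-j t refl = labelled t
            open VertexTasks (vertexTasks j fru) using () renaming (levels to levels-u)
            open VertexTasks (vertexTasks j frv) using () renaming (levels to levels-v)
            N-unique : AllPairs _≢_ (indices N)
            N-unique = All.map⁺ (All.++⁺
                (All.tabulate λ {t} t∈ → i∉ (joins-sym jn) frv t (heads-u t∈) (at-j t (levels-u t∈)))
                (All.tabulate λ {t} t∈ → i∉ jn fru t (heads-v t∈) (at-j t (levels-v t∈))))
              ∷ subst (AllPairs _≢_) (sym (List.map-++ index Nu Nv)) (AllPairs.++⁺ unique-u unique-v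
                (All.map⁺ (All.tabulate λ {t} t∈ → All.map⁺ (All.tabulate λ {t′} t′∈ →
                  u≠v t t′ (heads-u t∈) (heads-v t′∈) (at-j t (levels-u t∈)) (at-j t′ (levels-v t′∈))))))
            N-level : ∀ {t} → t ∈ N → lev t ≡ j
            N-level (here refl) = refl
            N-level (there t∈) = [ levels-u , levels-v ]′ (∈-++⁻ Nu t∈)
            newTails : ∀ {t} → t ∈ N ⊎ t ∈ [] → ¬ Incident G f (tailOf t)
            newTails {t} (inj₁ t∈) (inj₁ e) = tail-not-free {b = label t} (at-j t (N-level t∈)) (subst (Free (level j)) e fru)
            newTails {t} (inj₁ t∈) (inj₂ e) = tail-not-free {b = label t} (at-j t (N-level t∈)) (subst (Free (level j)) e frv)
            priv : ∀ {x k} → Incident G f x → owner x ≡ just k → k ∈ []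
            priv (inj₁ refl) o with trans (sym o) (free-unowned {level j} fru)
            ... | ()
            priv (inj₂ refl) o with trans (sym o) (free-unowned {level j} frv)
            ... | ()

          -- Growth of the set of releasable edges

          size : Labelling → ℕ
          size m = sum (λ i → ⟦ labelled? m i ⟧)

          Owned : Fin (V G) → Set
          Owned v = ∃ λ i → owner v ≡ just i

          module Growth {w a d} (owned? : ∀ v → Dec (Owned v))
            (large : ∀ c → n + d ≤ colourCount G col c) (s≤n : s ≤ n)
            (few-owned : sum (λ v → ⟦ owned? v ⟧) ≤ w) (a≤size : a ≤ size m₀) (1≤a : 1 ≤ a)
            (4w≤d : 4 * w ≤ d) (4nθ≤ad : 4 * (n * θ) ≤ a * d) where

            size-mono : ∀ m → size m ≤ size (next m)
            size-mono m = sum-mono λ i → ⟦⟧-mono (labelled? m i) (labelled? (next m) i) (λ (b , eq) → b , next-keeps eq)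

            a≤level : ∀ j → a ≤ size (level j)
            a≤level zero = a≤size
            a≤level (suc j) = ≤-trans (a≤level j) (size-mono (level j))

            -- `many-rich` applies because no free colour has an edge inside the free vertices. The
            -- rich edges it finds are unlabelled so far, and `next` labels all of them.
            grow : ∀ j → cost j + (cost j + cost j) ≤ B → d + 2 * size (level j) ≤ 2 * size (level (suc j))
            grow j small = begin
              d + 2 * size m           ≤⟨ +-monoˡ-≤ (2 * size m) enough ⟩
              2 * sum g + 2 * size m   ≡⟨ sym (*-distribˡ-+ 2 (sum g) (size m)) ⟩
              2 * (sum g + size m)     ≡⟨ cong (2 *_) (sym (∑-distrib-+ g (λ i → ⟦ labelled? m i ⟧))) ⟩
              2 * sum (λ i → g i + ⟦ labelled? m i ⟧) ≤⟨ *-monoʳ-≤ 2 (sum-mono bound) ⟩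
              2 * size (next m) ∎
              where
              open ≤-Reasoning
              m : Labelling
              m = level j
              r? : ∀ i → Dec (Rich (free? m) (col ∘ μ) (labelled? m) θ (μ i))
              r? i = rich? (free? m) (col ∘ μ) (labelled? m) θ (μ i)
              g : Fin s → ℕ
              g i = ⟦ ¬? (labelled? m i) ×-dec r? i ⟧
              cover : ∀ v → ¬ Free m v → Owned v ⊎ Covered v
              cover v ¬fr with covered? v
              ... | yes c = inj₂ c
              ... | no ¬c = inj₁ (by-owner (owner v) refl)
                where
                by-owner : ∀ o → owner v ≡ o → Owned v
                by-owner (just i) eq = i , eq
                by-owner nothing eq = ⊥-elim (¬fr (inj₁ (¬c , eq)))
              meets : ∀ i → Labelled m i → Free m (proj₁ (ends G (μ i))) ⊎ Free m (proj₂ (ends G (μ i)))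
              meets i (true , eq) = inj₂ (inj₂ (i , true , eq , refl))
              meets i (false , eq) = inj₁ (inj₂ (i , false , eq , refl))
              enough : d ≤ 2 * sum g
              enough = many-rich (free? m) owned? μ (labelled? m) cover meets (col ∘ μ) (labelled? m)
                (no-edge-inside j small) large s≤n few-owned (a≤level j) 1≤a 4w≤d 4nθ≤ad
              bound : ∀ i → g i + ⟦ labelled? m i ⟧ ≤ ⟦ labelled? (next m) i ⟧
              bound i = cases (labelled? m i) (r? i)
                where
                cases : (l : Dec (Labelled m i)) (r : Dec (Rich (free? m) (col ∘ μ) (labelled? m) θ (μ i))) →
                  ⟦ ¬? l ×-dec r ⟧ + ⟦ l ⟧ ≤ ⟦ labelled? (next m) i ⟧
                cases l@(yes (b , eq)) r = ⟦⟧-mono l (labelled? (next m) i) (λ (b , eq) → b , next-keeps eq)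
                cases (no _) (no _) = z≤n
                cases (no _) (yes r) = ≤-reflexive (sym (⟦⟧-true (labelled? (next m) i) (next-rich r)))

            accumulate : ∀ j → cost j + (cost j + cost j) ≤ B → j * d ≤ 2 * size (level j)
            accumulate zero _ = z≤n
            accumulate (suc j) small = ≤-trans (+-monoʳ-≤ d (accumulate j small′)) (grow j small′)
              where
              small′ : cost j + (cost j + cost j) ≤ B
              small′ = ≤-trans (+-mono-≤ (cost-mono j) (+-mono-≤ (cost-mono j) (cost-mono j))) small

            -- Every level adds at least `d / 2` labels, while there are only `s ≤ n` matching edges
            -- to label.
            exhausted : ∀ j → cost j + (cost j + cost j) ≤ B → ¬ (2 * n < j * d)
            exhausted j small lt = <⇒≱ lt (≤-trans (accumulate j small) (*-monoʳ-≤ 2 (≤-trans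
              (sum-mono (λ i → ⟦⟧≤1 (labelled? (level j) i))) (≤-trans (≤-reflexive (trans (sum-const s 1) (*-identityʳ s))) s≤n))))

-- Reserving outside vertices

module Seeding (G : MultiGraph) {n : ℕ} (col : Fin (E G) → Fin n) (proper : ProperColouring G n col)
  {s : ℕ} (μ : Fin s → Fin (E G))
  (disjoint : ∀ {i j v} → Incident G (μ i) v → Incident G (μ j) v → i ≡ j)
  (rainbow : ∀ {i j} → col (μ i) ≡ col (μ j) → i ≡ j) where
  open Counting G col proper
  open Switching G col proper
  open Fixed μ disjoint rainbow

  Used : Fin n → Set
  Used c = ∃ λ i → col (μ i) ≡ c

  abstract
    used? : ∀ c → Dec (Used c)
    used? c = Fin.any? λ i → col (μ i) ≟ c

  unused-many : n ≤ sum (λ c → ⟦ ¬? (used? c) ⟧) + s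
  unused-many = begin
    n
      ≡⟨ sym (trans (sum-const n 1) (*-identityʳ n)) ⟩
    sum {n} (λ _ → 1)
      ≤⟨ sum-mono used-or-not ⟩
    sum (λ c → ⟦ ¬? (used? c) ⟧ + sum (λ i → ⟦ col (μ i) ≟ c ⟧))
      ≡⟨ ∑-distrib-+ (λ c → ⟦ ¬? (used? c) ⟧) (λ c → sum (λ i → ⟦ col (μ i) ≟ c ⟧)) ⟩
    sum (λ c → ⟦ ¬? (used? c) ⟧) + sum (λ c → sum (λ i → ⟦ col (μ i) ≟ c ⟧))
      ≡⟨ cong (sum (λ c → ⟦ ¬? (used? c) ⟧) +_) (∑-comm (λ c i → ⟦ col (μ i) ≟ c ⟧)) ⟩
    sum (λ c → ⟦ ¬? (used? c) ⟧) + sum (λ i → sum (λ c → ⟦ col (μ i) ≟ c ⟧))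
      ≤⟨ +-monoʳ-≤ _ (sum-mono λ i → sum≤1 (col (μ i) ≟_) (λ p q → trans (sym p) q)) ⟩
    sum (λ c → ⟦ ¬? (used? c) ⟧) + sum {s} (λ _ → 1)
      ≡⟨ cong (sum (λ c → ⟦ ¬? (used? c) ⟧) +_) (trans (sum-const s 1) (*-identityʳ s)) ⟩
    sum (λ c → ⟦ ¬? (used? c) ⟧) + s ∎
    where
    open ≤-Reasoning
    used-or-not : ∀ c → 1 ≤ ⟦ ¬? (used? c) ⟧ + sum (λ i → ⟦ col (μ i) ≟ c ⟧)
    used-or-not c with used? c
    ... | no _ = s≤s z≤n
    ... | yes (i , e) = ≤-trans (≤-reflexive (sym (⟦⟧-true (col (μ i) ≟ c) e))) (term≤sum (λ i → ⟦ col (μ i) ≟ c ⟧) i)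

  -- Every labelled edge owns some vertices outside the matching, shared with no other edge, through which
  -- its tail can be rerouted in T unused colours.
  record Seed (T a : ℕ) : Set where
    field
      labelling : Labelling
      owner : Fin (V G) → Maybe (Fin s)
      owned? : ∀ v → Dec (∃ λ i → owner v ≡ just i)
      size : sum (λ i → ⟦ labelled? labelling i ⟧) ≡ a
      few-owned : sum (λ v → ⟦ owned? v ⟧) ≤ a * T
      outside : ∀ {v i} → owner v ≡ just i → ¬ Covered v
      options : ∀ {i b} → labelling i ≡ just b → ∀ Z → length Z < T → Reroute owner b i Z

  just? : ∀ {A : Set} (o : Maybe A) → Dec (∃ λ i → o ≡ just i)
  just? (just i) = yes (i , refl)
  just? nothing = no λ ()

  no-seed : ∀ {T} → Seed T 0
  no-seed = record
    { labelling = λ _ → nothing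
    ; owner = λ _ → nothing
    ; owned? = λ _ → no λ ()
    ; size = sum-zero λ i → ⟦⟧-false (labelled? (λ _ → nothing) i) λ ()
    ; few-owned = ≤-reflexive (sum-zero {V G} λ _ → refl)
    ; outside = λ ()
    ; options = λ () }

  module Extend {T K d : ℕ} (T>0 : 1 ≤ T) (K>0 : 1 ≤ K) (s≤n : s ≤ n) (room : s + K ≤ n)
    (large : ∀ c → n + d ≤ colourCount G col c) (T-small : 4 * (n * T) ≤ K * d)
    (maximal : ∀ {Y P} → RainbowMatching Y → (∀ {i f} → f ∈ Y → Conflict i f → i ∈ P) →
      ¬ (length P < length Y)) where

    module _ {a : ℕ} (seed : Seed T a) (a-small : 4 * (suc a * T) ≤ d) where
      open Seed seed

      Unowned : Fin (V G) → Set
      Unowned v = ¬ Covered v × ¬ (∃ λ i → owner v ≡ just i)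

      unowned? : ∀ v → Dec (Unowned v)
      unowned? v = ¬? (covered? v) ×-dec ¬? (owned? v)

      unused? : ∀ c → Dec (¬ Used c)
      unused? c = ¬? (used? c)

      -- Such an edge conflicts with nothing in the matching, so it could simply be added: the
      -- exchange with `P` empty.
      no-unused-edge : ∀ c → ¬ Used c → NoEdgeInside Unowned c
      no-unused-edge c unused f ce ((¬u , _) , (¬v , _)) = maximal {f ∷ []} {[]} ([] ∷ []) conf (s≤s z≤n)
        where
        conf : ∀ {i g} → g ∈ f ∷ [] → Conflict i g → i ∈ []
        conf (here refl) (inj₁ (_ , p , inj₁ refl)) = ⊥-elim (¬u (_ , p))
        conf (here refl) (inj₁ (_ , p , inj₂ refl)) = ⊥-elim (¬v (_ , p))
        conf (here refl) (inj₂ e) = ⊥-elim (unused (_ , trans e ce))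

      unusedInto : Fin (V G) → ℕ
      unusedInto = coloursInto unowned? id unused?

      R : Fin s → Set
      R i = Rich unowned? id unused? T (μ i)

      r? : ∀ i → Dec (R i)
      r? i = rich? unowned? id unused? T (μ i)

      new-edge : ∃ λ i → R i × ¬ Labelled labelling i
      new-edge = conclude (exceeds {f = λ i → ⟦ yes₀ ×-dec r? i ⟧} {g = λ i → ⟦ labelled? labelling i ⟧}
                  (≤-trans (s≤s (≤-reflexive size)) (*-cancelˡ-< 2 a _ (≤-trans 2a<d enough))))
        where
        -- `D` is empty here; this is the trivial factor it leaves in the conclusion of `many-rich`.
        yes₀ : Dec (¬ ⊥)
        yes₀ = ¬? (no id)
        cover : ∀ v → ¬ Unowned v → (∃ λ i → owner v ≡ just i) ⊎ Covered v
        cover v ¬un with covered? v | owned? v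
        ... | yes c | _ = inj₂ c
        ... | no _ | yes o = inj₁ o
        ... | no ¬c | no ¬o = ⊥-elim (¬un (¬c , ¬o))
        enough : d ≤ 2 * sum (λ i → ⟦ yes₀ ×-dec r? i ⟧)
        enough = many-rich unowned? owned? μ {D = λ _ → ⊥} (λ _ → no id) cover (λ _ ()) id unused?
          no-unused-edge large s≤n few-owned (+-cancelʳ-≤ s K _ (≤-trans (≤-reflexive (+-comm K s)) (≤-trans room unused-many)))
          K>0 (≤-trans (*-monoʳ-≤ 4 (m≤n+m (a * T) T)) a-small) T-small
        2a<d : 2 * a < d
        2a<d = begin-strict
          2 * a              <⟨ *-monoʳ-< 2 (n<1+n a) ⟩
          2 * suc a          ≤⟨ *-monoˡ-≤ (suc a) (s≤s (s≤s (z≤n {2}))) ⟩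
          4 * suc a          ≡⟨ cong (4 *_) (sym (*-identityʳ (suc a))) ⟩
          4 * (suc a * 1)    ≤⟨ *-monoʳ-≤ 4 (*-monoʳ-≤ (suc a) T>0) ⟩
          4 * (suc a * T)    ≤⟨ a-small ⟩
          d ∎
          where open ≤-Reasoning
        conclude : (∃ λ i → ⟦ labelled? labelling i ⟧ < ⟦ yes₀ ×-dec r? i ⟧) → ∃ λ i → R i × ¬ Labelled labelling i
        conclude (i , lt) with ⟦⟧-exceeds (yes₀ ×-dec r? i) lt
        ... | (_ , r) , z = i , r , ⟦⟧≡0 (labelled? labelling i) z

      module _ (i : Fin s) (fresh : ¬ Labelled labelling i) (b : Bool) (sel : Fin n → Bool)
        (selected : ∀ c → sel c ≡ true → ¬ Used c × EdgeInto Unowned c (tail b i))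
        (total : sum (λ c → ⟦ sel c Bool.≟ true ⟧) ≡ T) where

        private
          Via : Fin n → Fin (V G) → Set
          Via c v = ∃ λ f → Joins G f (tail b i) v × col f ≡ c

          via? : ∀ c v → Dec (Via c v)
          via? c v = Fin.any? λ f → joins? G (tail b i) v f ×-dec (col f ≟ c)

          -- Properness leaves one edge of colour `c` at the tail. So the `T` selected colours claim
          -- at most `T` vertices, and these are the ones known to be unowned.
          via-unique : ∀ c {v v′} → Via c v → Via c v′ → v ≡ v′
          via-unique c (f , jn , e) (f′ , jn′ , e′)
            with monochromatic-unique (trans e (sym e′)) (joins-incident jn) (joins-incident jn′)
          ... | refl with incident-joins jn (joins-incident (joins-sym jn′))
          ... | inj₁ eq = ⊥-elim (joins-≢ jn′ (sym eq))
          ... | inj₂ eq = sym eq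

          New : Fin (V G) → Set
          New v = ∃ λ c → sel c ≡ true × Via c v

          abstract
            new? : ∀ v → Dec (New v)
            new? v = Fin.any? λ c → (sel c Bool.≟ true) ×-dec via? c v

          new-unowned : ∀ {v} → New v → Unowned v
          new-unowned (c , eq , via) with selected c eq
          ... | _ , f , u , jn , e , un = subst Unowned (via-unique c (f , jn , e) via) un

          relabel : ∀ {k} → Dec (k ≡ i) → Labelling
          relabel (yes _) _ = just b
          relabel (no _) k = labelling k

          labelling′ : Labelling
          labelling′ k = relabel (k ≟ i) k

          owner′ : Fin (V G) → Maybe (Fin s)
          owner′ v with new? v
          ... | yes _ = just i
          ... | no _ = owner v

          owner-new : ∀ {v} → New v → owner′ v ≡ just i
          owner-new {v} nw with new? v
          ... | yes _ = refl
          ... | no ¬nw = ⊥-elim (¬nw nw)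

          owner-old : ∀ {v k} → owner v ≡ just k → owner′ v ≡ just k
          owner-old {v} eq with new? v
          ... | yes nw = ⊥-elim (proj₂ (new-unowned nw) (_ , eq))
          ... | no _ = eq

          owner-inv : ∀ {v k} → owner′ v ≡ just k → New v ⊎ owner v ≡ just k
          owner-inv {v} eq with new? v
          ... | yes nw = inj₁ nw
          ... | no _ = inj₂ eq

          size′ : sum (λ k → ⟦ labelled? labelling′ k ⟧) ≡ suc a
          size′ = begin
            sum (λ k → ⟦ labelled? labelling′ k ⟧)
              ≡⟨ sum-cong-≗ each ⟩
            sum (λ k → ⟦ k ≟ i ⟧ + ⟦ labelled? labelling k ⟧)
              ≡⟨ ∑-distrib-+ (λ k → ⟦ k ≟ i ⟧) (λ k → ⟦ labelled? labelling k ⟧) ⟩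
            sum (λ k → ⟦ k ≟ i ⟧) + sum (λ k → ⟦ labelled? labelling k ⟧)
              ≡⟨ cong₂ _+_ (≤-antisym (sum≤1 (_≟ i) (λ p q → trans p (sym q)))
                   (≤-trans (≤-reflexive (sym (⟦⟧-true (i ≟ i) refl))) (term≤sum (λ k → ⟦ k ≟ i ⟧) i))) size ⟩
            suc a ∎
            where
            open ≡-Reasoning
            each : ∀ k → ⟦ labelled? labelling′ k ⟧ ≡ ⟦ k ≟ i ⟧ + ⟦ labelled? labelling k ⟧
            each k = each′ (k ≟ i) (labelled? labelling′ k) (labelled? labelling k)
              where
              add-label : k ≡ i → Labelled labelling′ k
              add-label eq with k ≟ i
              ... | yes _ = b , refl
              ... | no ne = ⊥-elim (ne eq)
              keep : k ≢ i → labelling′ k ≡ labelling k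
              keep ne with k ≟ i
              ... | yes eq = ⊥-elim (ne eq)
              ... | no _ = refl
              each′ : (e : Dec (k ≡ i)) (l′ : Dec (Labelled labelling′ k)) (l : Dec (Labelled labelling k)) →
                ⟦ l′ ⟧ ≡ ⟦ e ⟧ + ⟦ l ⟧
              each′ (yes eq) l′ l = trans (⟦⟧-true l′ (add-label eq))
                (sym (cong suc (⟦⟧-false l (λ lb → fresh (subst (Labelled labelling) eq lb)))))
              each′ (no ne) l′ l = ≤-antisym
                (⟦⟧-mono l′ l (λ (c , eq) → c , trans (sym (keep ne)) eq))
                (⟦⟧-mono l l′ (λ (c , eq) → c , trans (keep ne) eq))

          few-owned′ : sum (λ v → ⟦ just? (owner′ v) ⟧) ≤ suc a * T
          few-owned′ = begin
            sum (λ v → ⟦ just? (owner′ v) ⟧)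
              ≤⟨ sum-mono (λ v → ⟦⟧-⊎ (just? (owner′ v)) (new? v) (owned? v)
                   (λ (k , eq) → Sum.map₂ (k ,_) (owner-inv eq))) ⟩
            sum (λ v → ⟦ new? v ⟧ + ⟦ owned? v ⟧)
              ≡⟨ ∑-distrib-+ (λ v → ⟦ new? v ⟧) (λ v → ⟦ owned? v ⟧) ⟩
            sum (λ v → ⟦ new? v ⟧) + sum (λ v → ⟦ owned? v ⟧)
              ≤⟨ +-mono-≤ (≤-trans (image-bound (λ c → sel c Bool.≟ true) via? via-unique new?)
                   (≤-reflexive total)) few-owned ⟩
            T + a * T ∎
            where open ≤-Reasoning

          -- There are `T` selected colours and fewer than `T` forbidden ones, so one survives
          -- together with its edge.
          new-options : ∀ Z → length Z < T → Reroute owner′ b i Z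
          new-options Z short = use (exceeds {f = λ c → ⟦ sel c Bool.≟ true ⟧} {g = λ c → ⟦ c ∈? Z ⟧}
            (≤-<-trans (∈-bound Z) (<-≤-trans short (≤-reflexive (sym total)))))
            where
            use′ : ∀ c → sel c ≡ true → c ∉ Z → ¬ Used c × EdgeInto Unowned c (tail b i) → Reroute owner′ b i Z
            use′ c sc c∉Z (unused , f , w , jn , refl , _) =
              f , w , jn , owner-new (c , sc , f , jn , refl) , (λ l e → unused (l , e)) , c∉Z
            use : (∃ λ c → ⟦ c ∈? Z ⟧ < ⟦ sel c Bool.≟ true ⟧) → Reroute owner′ b i Z
            use (c , lt) = let (sc , z) = ⟦⟧-exceeds (sel c Bool.≟ true) lt
                           in use′ c sc (⟦⟧≡0 (c ∈? Z) z) (selected c sc)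

          options′ : ∀ {k c} → labelling′ k ≡ just c → ∀ Z → length Z < T → Reroute owner′ c k Z
          options′ {k} {c} eq Z short = split (k ≟ i) eq
            where
            split : (e : Dec (k ≡ i)) → relabel e k ≡ just c → Reroute owner′ c k Z
            split (yes refl) refl = new-options Z short
            split (no _) eq = let (f , w , jn , ow , rest) = options eq Z short
                              in f , w , jn , owner-old ow , rest

        enlarged : Seed T (suc a)
        enlarged = record
          { labelling = labelling′ ; owner = owner′ ; owned? = λ v → just? (owner′ v)
          ; size = size′ ; few-owned = few-owned′
          ; outside = λ eq → [ (λ nw → proj₁ (new-unowned nw)) , outside ]′ (owner-inv eq)
          ; options = options′ }

      extend : Seed T (suc a)
      extend = let (i , r , fresh) = new-edge in [ widen i fresh true , widen i fresh false ]′ r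
        where
        widen : ∀ i → ¬ Labelled labelling i → ∀ b → T ≤ unusedInto (tail b i) → Seed T (suc a)
        widen i fresh b many = let (sel , selected , total) = shrink good? T (≤-trans many (≤-reflexive (sum-cong-≗
                                     λ c → sym (⟦⟧-× (unused? c) (edgeInto? unowned? c (tail b i))))))
                               in enlarged i fresh b sel selected total
          where
          good? : ∀ c → Dec (¬ Used c × EdgeInto Unowned c (tail b i))
          good? c = unused? c ×-dec edgeInto? unowned? c (tail b i)

    seeds : ∀ a → 4 * (a * T) ≤ d → Seed T a
    seeds zero _ = no-seed
    seeds (suc a) le = extend (seeds a (≤-trans (*-monoʳ-≤ 4 (m≤n+m (a * T) T)) le)) le

-- Augmentation

lookup-pair : ∀ {A : Set} {R : A → A → Set} → (∀ {x y} → R x y → R y x) →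
  ∀ {xs} → AllPairs R xs → ∀ {i j} → i ≢ j → R (lookup xs i) (lookup xs j)
lookup-pair symR (_ ∷ _) {zero} {zero} ne = ⊥-elim (ne refl)
lookup-pair symR (h ∷ _) {zero} {suc j} ne = All.lookup h (∈-lookup j)
lookup-pair symR (h ∷ _) {suc i} {zero} ne = symR (All.lookup h (∈-lookup i))
lookup-pair symR (_ ∷ ps) {suc i} {suc j} ne = lookup-pair symR ps (ne ∘ cong suc)

-- There are finitely many lists of a given length; deciding among them lets a larger rainbow
-- matching be extracted from a proof by contradiction.
search : ∀ {e} {P : List (Fin e) → Set} → (∀ l → Dec (P l)) → ∀ m → Dec (∃ λ l → length l ≡ m × P l)
search P? zero = map′ (λ p → [] , refl , p) (λ { ([] , refl , p) → p }) (P? [])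
search P? (suc m) = map′ (λ { (x , l , refl , p) → x ∷ l , refl , p }) (λ { (x ∷ l , refl , p) → x , l , refl , p })
  (Fin.any? λ x → search (λ l → P? (x ∷ l)) m)

module Augmentation (G : MultiGraph) {n : ℕ} (col : Fin (E G) → Fin n) (proper : ProperColouring G n col) where
  open Counting G col proper
  open Switching G col proper

  share-sym : ∀ {e f} → ShareEndpoint G e f → ShareEndpoint G f e
  share-sym sh = let (_ , p , q) = shared sh in share q p

  rainbowMatching? : ∀ M → Dec (RainbowMatching M)
  rainbowMatching? = AllPairs.allPairs? λ e f →
    ¬? (incident? f (proj₁ (ends G e)) ⊎-dec incident? f (proj₂ (ends G e))) ×-dec ¬? (col e ≟ col f)

  module _ {K d δ T a θ J B : ℕ}
    (large : ∀ c → n + d ≤ colourCount G col c) (multiplicities : ∀ u w → multiplicity G u w ≤ δ) where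

    module _ {M : List (Fin (E G))} (rm : RainbowMatching M) (room : length M + K ≤ n)
      (no-larger : ¬ ∃ λ Z → length Z ≡ suc (length M) × RainbowMatching Z) where

      private
        s : ℕ
        s = length M

        μ : Fin s → Fin (E G)
        μ = lookup M

        compatible : ∀ {i j} → i ≢ j → ¬ ShareEndpoint G (μ i) (μ j) × col (μ i) ≢ col (μ j)
        compatible = lookup-pair (λ (p , q) → p ∘ share-sym , q ∘ sym) rm

      disjoint : ∀ {i j v} → Incident G (μ i) v → Incident G (μ j) v → i ≡ j
      disjoint {i} {j} p q = decidable-stable (i ≟ j) λ ne → proj₁ (compatible ne) (share p q)

      rainbow : ∀ {i j} → col (μ i) ≡ col (μ j) → i ≡ j
      rainbow {i} {j} e = decidable-stable (i ≟ j) λ ne → proj₂ (compatible ne) e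

      open Fixed μ disjoint rainbow

      -- Delete the edges indexed by `P` and insert `Y`. The result is a rainbow matching because
      -- `Y` conflicts with nothing that is kept, and at most `length P` edges were lost.
      maximal : ∀ {Y P} → RainbowMatching Y → (∀ {i f} → f ∈ Y → Conflict i f → i ∈ P) → ¬ (length P < length Y)
      maximal {Y} {P} rmY conf lt = no-larger
        -- `no-larger` speaks of size `s + 1` only, so the enlarged matching is cut down to it.
        (take (suc s) Z , trans (List.length-take (suc s) Z) (m≤n⇒m⊓n≡m Z-long) , AllPairs.take⁺ (suc s) Z-rainbow)
        where
        open ≤-Reasoning
        kept : List (Fin s)
        kept = filter (λ i → ¬? (i ∈? P)) (allFin s)
        Z : List (Fin (E G))
        Z = Y ++ map μ kept
        Z-rainbow : RainbowMatching Z
        Z-rainbow = AllPairs.++⁺ rmY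
          (AllPairs.map⁺ (AllPairs.filter⁺ (λ i → ¬? (i ∈? P)) (AllPairs.tabulate⁺ compatible)))
          (All.tabulate λ f∈ → All.map⁺ (All.map
            (λ i∉ → (λ sh → let (v , p , q) = shared sh in i∉ (conf f∈ (inj₁ (v , q , p)))) ,
                    (λ e → i∉ (conf f∈ (inj₂ (sym e)))))
            (All.all-filter (λ i → ¬? (i ∈? P)) (allFin s))))
        kept-many : s ≤ length kept + length P
        kept-many = begin
          s
            ≡⟨ sym (trans (sum-const s 1) (*-identityʳ s)) ⟩
          sum {s} (λ _ → 1)
            ≤⟨ sum-mono each ⟩
          sum (λ i → ⟦ ¬? (i ∈? P) ⟧ + ⟦ i ∈? P ⟧)
            ≡⟨ ∑-distrib-+ (λ i → ⟦ ¬? (i ∈? P) ⟧) (λ i → ⟦ i ∈? P ⟧) ⟩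
          sum (λ i → ⟦ ¬? (i ∈? P) ⟧) + sum (λ i → ⟦ i ∈? P ⟧)
            ≤⟨ +-mono-≤ (≤-reflexive (sym (count≡sum s (λ i → ¬? (i ∈? P))))) (∈-bound P) ⟩
          length kept + length P ∎
          where
          each : ∀ i → 1 ≤ ⟦ ¬? (i ∈? P) ⟧ + ⟦ i ∈? P ⟧
          each i with i ∈? P
          ... | yes _ = s≤s z≤n
          ... | no _ = s≤s z≤n
        Z-long : suc s ≤ length Z
        Z-long = begin
          suc s                          ≤⟨ s≤s kept-many ⟩
          suc (length kept + length P)   ≡⟨ sym (+-suc (length kept) (length P)) ⟩
          length kept + suc (length P)   ≤⟨ +-monoʳ-≤ (length kept) lt ⟩
          length kept + length Y         ≡⟨ +-comm (length kept) (length Y) ⟩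
          length Y + length kept         ≡⟨ cong (length Y +_) (sym (List.length-map μ kept)) ⟩
          length Y + length (map μ kept) ≡⟨ sym (List.length-++ Y) ⟩
          length Z ∎

      open Seeding G col proper μ disjoint rainbow

      s≤n : s ≤ n
      s≤n = ≤-trans (m≤m+n s K) room

      contradictory : 1 ≤ T → 1 ≤ K → 1 ≤ a → 4 * (n * T) ≤ K * d → 4 * (a * T) ≤ d →
        4 * (n * θ) ≤ a * d → T + (T + T) * 2 * δ < θ → suc B < T →
        cost J + (cost J + cost J) ≤ B → 2 * n < J * d → ⊥
      contradictory T>0 K>0 a>0 T-small a-small θ-small θ-large B<T cost-bound J-large =
        exhausted J cost-bound J-large
        where
        open Seed (Extend.seeds T>0 K>0 s≤n room large T-small maximal a a-small)
        open Levels labelling owner θ using (module Search)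
        open Search outside using (module Run)
        open Run T B δ B<T multiplicities θ-large options maximal using (module Growth)
        open Growth owned? large s≤n few-owned (≤-reflexive (sym size)) a>0 a-small θ-small

-- Choice of parameters

n<2^n : ∀ n → n < 2 ^ n
n<2^n zero = s≤s z≤n
n<2^n (suc n) = begin
  suc (suc n)            ≤⟨ s≤s (n<2^n n) ⟩
  1 + 2 ^ n              ≤⟨ +-monoˡ-≤ (2 ^ n) (≤-trans (s≤s z≤n) (n<2^n n)) ⟩
  2 ^ n + 2 ^ n          ≡⟨ cong (2 ^ n +_) (sym (+-identityʳ (2 ^ n))) ⟩
  2 ^ suc n ∎
  where open ≤-Reasoning

cost+1≡2^ : ∀ j → suc (cost j) ≡ 2 ^ suc j
cost+1≡2^ zero = refl
cost+1≡2^ (suc j) = trans (double (cost j)) (cong (2 *_) (cost+1≡2^ j))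
  where
  double : ∀ c → suc (suc (c + c)) ≡ 2 * suc c
  double = solve-∀

-- `L` stands for `1/ε` rounded down. Then `K` is at most `k`, `Λ` exceeds `1/ε`, `J` is the number
-- of levels after which the matching is used up, and `T` exceeds the number of switches in an
-- exchange of level `J`.
module Parameters (L : ℕ) (2≤L : 2 ≤ L) where

  K T J Λ : ℕ
  K = 2 ^ (20 * L)
  T = 2 ^ (6 + (L + L))
  J = 3 + (L + L)
  Λ = suc L

  K>0 : 1 ≤ K
  K>0 = m^n>0 2 (20 * L)

  T>0 : 1 ≤ T
  T>0 = m^n>0 2 (6 + (L + L))

  -- The bound behind `θ-small`, where 192 arises as 24 times 8. As `Λ * T` is at most 2 to the
  -- power `3 * L + 6`, the exponents compare as `20 + 6 * L ≤ 20 * L`, which holds from `L = 2` on.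
  K-large : 192 * ((Λ * T) * (Λ * T)) ≤ K
  K-large = begin
    192 * ((Λ * T) * (Λ * T))
      ≤⟨ *-mono-≤ (toWitness {a? = 192 ≤? 256} _) (*-mono-≤ X≤ X≤) ⟩
    2 ^ 8 * (2 ^ e * 2 ^ e)
      ≡⟨ trans (cong (2 ^ 8 *_) (sym (^-distribˡ-+-* 2 e e))) (sym (^-distribˡ-+-* 2 8 (e + e))) ⟩
    2 ^ (8 + (e + e))
      ≤⟨ ^-monoʳ-≤ 2 exponents ⟩
    K ∎
    where
    open ≤-Reasoning
    e : ℕ
    e = L + (6 + (L + L))
    X≤ : Λ * T ≤ 2 ^ e
    X≤ = ≤-trans (*-monoˡ-≤ T (n<2^n L)) (≤-reflexive (sym (^-distribˡ-+-* 2 L (6 + (L + L)))))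
    exponents : 8 + (e + e) ≤ 20 * L
    exponents = begin
      8 + (e + e)            ≡⟨ eq₁ L ⟩
      10 * 2 + 6 * L         ≤⟨ +-monoˡ-≤ (6 * L) (*-monoʳ-≤ 10 2≤L) ⟩
      10 * L + 6 * L         ≤⟨ m≤m+n (10 * L + 6 * L) (4 * L) ⟩
      10 * L + 6 * L + 4 * L ≡⟨ eq₂ L ⟩
      20 * L ∎
      where
      eq₁ : ∀ L → 8 + (L + (6 + (L + L)) + (L + (6 + (L + L)))) ≡ 10 * 2 + 6 * L
      eq₁ = solve-∀
      eq₂ : ∀ L → 10 * L + 6 * L + 4 * L ≡ 20 * L
      eq₂ = solve-∀

  K-large′ : 4 * (Λ * T) ≤ K
  K-large′ = ≤-trans (*-mono-≤ (toWitness {a? = 4 ≤? 192} _) (m≤m*n (Λ * T) (Λ * T) {{>-nonZero (*-mono-≤ {1} {Λ} (s≤s z≤n) T>0)}})) K-large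

  B : ℕ
  B = cost J + (cost J + cost J)

  -- `T` was chosen as four times `suc (cost J)`, and `B` is three times `cost J`.
  B<T : suc B < T
  B<T = begin
    2 + (cost J + (cost J + cost J))  ≤⟨ m≤m+n _ (2 + cost J) ⟩
    2 + (cost J + (cost J + cost J)) + (2 + cost J) ≡⟨ eq (cost J) ⟩
    2 * (2 * suc (cost J))            ≡⟨ cong (λ x → 2 * (2 * x)) (cost+1≡2^ J) ⟩
    T ∎
    where
    open ≤-Reasoning
    eq : ∀ c → 2 + (c + (c + c)) + (2 + c) ≡ 2 * (2 * suc c)
    eq = solve-∀

  module _ (n d : ℕ) (K≤n : K ≤ n) (n≤Λd : n ≤ Λ * d) where

    instance
      K≢0 : NonZero K
      K≢0 = m^n≢0 2 (20 * L)

      4T≢0 : NonZero (4 * T)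
      4T≢0 = >-nonZero (*-mono-≤ {1} {4} (s≤s z≤n) T>0)

    -- `a` is the largest number of seeds whose reserves satisfy `4 * (a * T) ≤ d`; `θ` is the least
    -- threshold above the exclusions counted in `Run`.
    δ a θ : ℕ
    δ = n / K
    a = d / (4 * T)
    θ = suc (T + (T + T) * 2 * δ)

    δ>0 : 1 ≤ δ
    δ>0 = ≤-trans (≤-reflexive (sym (n/n≡1 K))) (/-monoˡ-≤ K K≤n)

    4T≤d : 4 * T ≤ d
    4T≤d = *-cancelˡ-≤ Λ (begin
      Λ * (4 * T) ≡⟨ eq Λ T ⟩
      4 * (Λ * T) ≤⟨ K-large′ ⟩
      K           ≤⟨ K≤n ⟩
      n           ≤⟨ n≤Λd ⟩
      Λ * d ∎)
      where
      open ≤-Reasoning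
      eq : ∀ x y → x * (4 * y) ≡ 4 * (x * y)
      eq = solve-∀

    d>0 : 1 ≤ d
    d>0 = ≤-trans (*-mono-≤ {1} {4} (s≤s z≤n) T>0) 4T≤d

    a>0 : 1 ≤ a
    a>0 = ≤-trans (≤-reflexive (sym (n/n≡1 (4 * T)))) (/-monoˡ-≤ (4 * T) 4T≤d)

    a-small : 4 * (a * T) ≤ d
    a-small = ≤-trans (≤-reflexive (eq a T)) (m/n*n≤m d (4 * T))
      where
      eq : ∀ x y → 4 * (x * y) ≡ x * (4 * y)
      eq = solve-∀

    T-small : 4 * (n * T) ≤ K * d
    T-small = begin
      4 * (n * T)         ≤⟨ *-monoʳ-≤ 4 (*-monoˡ-≤ T n≤Λd) ⟩
      4 * (Λ * d * T)     ≡⟨ eq Λ d T ⟩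
      4 * (Λ * T) * d     ≤⟨ *-monoˡ-≤ d K-large′ ⟩
      K * d ∎
      where
      open ≤-Reasoning
      eq : ∀ x y z → 4 * (x * y * z) ≡ 4 * (x * z) * y
      eq = solve-∀

    d≤8Ta : d ≤ 8 * (T * a)
    d≤8Ta = begin
      d                         ≡⟨ m≡m%n+[m/n]*n d (4 * T) ⟩
      d % (4 * T) + a * (4 * T) ≤⟨ +-monoˡ-≤ (a * (4 * T)) (<⇒≤ (m%n<n d (4 * T))) ⟩
      4 * T + a * (4 * T)       ≤⟨ +-monoˡ-≤ (a * (4 * T)) (m≤n*m (4 * T) a {{>-nonZero a>0}}) ⟩
      a * (4 * T) + a * (4 * T) ≡⟨ eq a T ⟩
      8 * (T * a) ∎
      where
      open ≤-Reasoning
      eq : ∀ x y → x * (4 * y) + x * (4 * y) ≡ 8 * (y * x)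
      eq = solve-∀

    θ≤6Tδ : θ ≤ 6 * (T * δ)
    θ≤6Tδ = begin
      1 + (T + (T + T) * 2 * δ)       ≤⟨ +-mono-≤ (*-mono-≤ T>0 δ>0) (+-monoˡ-≤ ((T + T) * 2 * δ) (m≤m*n T δ {{>-nonZero δ>0}})) ⟩
      T * δ + (T * δ + (T + T) * 2 * δ) ≡⟨ eq T δ ⟩
      6 * (T * δ) ∎
      where
      open ≤-Reasoning
      eq : ∀ x y → x * y + (x * y + (x + x) * 2 * y) ≡ 6 * (x * y)
      eq = solve-∀

    -- Since `θ` is of order `T * δ` and `a` of order `d / T`, multiplying by `K` turns `δ` into at
    -- most `n`, and `n ≤ Λ * d` leaves a factor of order `Λ * Λ * T * T`, which `K` dominates.
    θ-small : 4 * (n * θ) ≤ a * d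
    θ-small = *-cancelˡ-≤ K (begin
      K * (4 * (n * θ))                      ≤⟨ *-monoʳ-≤ K (*-monoʳ-≤ 4 (*-monoʳ-≤ n θ≤6Tδ)) ⟩
      K * (4 * (n * (6 * (T * δ))))          ≡⟨ eq₁ K n T δ ⟩
      24 * (n * T * (δ * K))                 ≤⟨ *-monoʳ-≤ 24 (*-monoʳ-≤ (n * T) (m/n*n≤m n K)) ⟩
      24 * (n * T * n)                       ≤⟨ *-monoʳ-≤ 24 (*-mono-≤ (*-monoˡ-≤ T n≤Λd) n≤Λd) ⟩
      24 * (Λ * d * T * (Λ * d))             ≤⟨ *-monoʳ-≤ 24 (*-monoʳ-≤ (Λ * d * T) (*-monoʳ-≤ Λ d≤8Ta)) ⟩
      24 * (Λ * d * T * (Λ * (8 * (T * a)))) ≡⟨ eq₂ Λ d T a ⟩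
      192 * ((Λ * T) * (Λ * T)) * (a * d)    ≤⟨ *-monoˡ-≤ (a * d) K-large ⟩
      K * (a * d) ∎)
      where
      open ≤-Reasoning
      eq₁ : ∀ k n t δ → k * (4 * (n * (6 * (t * δ)))) ≡ 24 * (n * t * (δ * k))
      eq₁ = solve-∀
      eq₂ : ∀ l d t a → 24 * (l * d * t * (l * (8 * (t * a)))) ≡ 192 * ((l * t) * (l * t)) * (a * d)
      eq₂ = solve-∀

    -- `J` equals `1 + 2 * Λ`: the `2 * Λ` levels cover `2 * n`, and one more makes the inequality
    -- strict.
    J-large : 2 * n < J * d
    J-large = begin-strict
      2 * n                 <⟨ m<n+m (2 * n) d>0 ⟩
      d + 2 * n             ≤⟨ +-monoʳ-≤ d (*-monoʳ-≤ 2 n≤Λd) ⟩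
      d + 2 * (suc L * d)   ≡⟨ eq L d ⟩
      J * d ∎
      where
      open ≤-Reasoning
      eq : ∀ l d → d + 2 * (suc l * d) ≡ (3 + (l + l)) * d
      eq = solve-∀

  module _ (n d : ℕ) (K≤n : K ≤ n) (n≤Λd : n ≤ Λ * d)
    (G : MultiGraph) (col : Fin (E G) → Fin n) (proper : ProperColouring G n col)
    (large : ∀ c → n + d ≤ colourCount G col c)
    (multiplicities : ∀ u w → multiplicity G u w * K ≤ n) where
    open Switching G col proper using (RainbowMatching)
    open Augmentation G col proper

    -- Instead of taking a maximum matching, the size is raised by one at a time; the exchange
    -- argument runs against the failure of the next size.
    rainbowMatching : ∀ s → s + K ≤ n → ∃ λ M → length M ≡ s × RainbowMatching M
    rainbowMatching zero _ = [] , refl , []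
    rainbowMatching (suc s) room with rainbowMatching s (<⇒≤ room)
    ... | M , refl , rm = decidable-stable (search rainbowMatching? (suc s)) λ no-larger →
      contradictory {K} {d} {δ n d K≤n n≤Λd} {T} {a n d K≤n n≤Λd} {θ n d K≤n n≤Λd} {J} {B} large multiplicity≤δ rm (<⇒≤ room) no-larger T>0 K>0
        (a>0 n d K≤n n≤Λd) (T-small n d K≤n n≤Λd) (a-small n d K≤n n≤Λd) (θ-small n d K≤n n≤Λd)
        ≤-refl B<T ≤-refl (J-large n d K≤n n≤Λd)
      where
      multiplicity≤δ : ∀ u w → multiplicity G u w ≤ δ n d K≤n n≤Λd
      multiplicity≤δ u w = ≤-trans (≤-reflexive (sym (m*n/n≡m (multiplicity G u w) K {{m^n≢0 2 (20 * L)}})))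
        (/-monoˡ-≤ K {{m^n≢0 2 (20 * L)}} (multiplicities u w))

-- From rational `ε` and real `k` to natural numbers

^-cancelʳ-≤ : ∀ p {x y} → 1 ≤ p → x ^ p ≤ y ^ p → x ≤ y
^-cancelʳ-≤ p p>0 le = ≮⇒≥ λ lt → <⇒≱ (^-monoˡ-< p {{>-nonZero p>0}} lt) le

^-distribʳ-* : ∀ p x y → (x * y) ^ p ≡ x ^ p * y ^ p
^-distribʳ-* zero x y = refl
^-distribʳ-* (suc p) x y = trans (cong (x * y *_) (^-distribʳ-* p x y)) (eq x y (x ^ p) (y ^ p))
  where
  eq : ∀ a b c d → a * b * (c * d) ≡ a * c * (b * d)
  eq = solve-∀

theorem1p3 : (p q : ℕ) → 1 ≤ p → 1000 * p < q →
    (n : ℕ) → GreaterThanKSq p q n →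
    (G : MultiGraph) →
    (∀ u w → AtMostNOverK p q n (multiplicity G u w)) →
    (col : Fin (E G) → Fin n) → ProperColouring G n col →
    (∀ c → (q + p) * n ≤ q * colourCount G col c) →
    Σ (List (Fin (E G))) (λ M →
    IsMatching G M × IsRainbow G col M × AtLeastNMinusK p q n (length M))
theorem1p3 p q p>0 1000p<q n n>k² G multiplicities col proper large =
  M , AllPairs.map (λ (sh , ne) → (λ { refl → ne refl }) , sh) rm , AllPairs.map proj₂ rm , size
  where
  open ≤-Reasoning
  instance
    p≢0 : NonZero p
    p≢0 = >-nonZero p>0

  L : ℕ
  L = q / p

  2≤L : 2 ≤ L
  2≤L = begin
    2           ≡⟨ sym (m*n/n≡m 2 p) ⟩
    2 * p / p   ≤⟨ /-monoˡ-≤ p (≤-trans (*-monoˡ-≤ p (s≤s (s≤s (z≤n {998})))) (<⇒≤ 1000p<q)) ⟩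
    q / p ∎

  open Parameters L 2≤L

  d : ℕ
  -- This is `n / Λ` rounded up.
  d = (n + L) / Λ

  -- So `K ≤ k`. Rounding down is harmless on both sides: the multiplicity bound `n / k` implies
  -- `n / K`, and size `n - K` is at least `n - k`.
  K^p≤ : K ^ p ≤ 2 ^ (20 * q)
  K^p≤ = begin
    (2 ^ (20 * L)) ^ p    ≡⟨ ^-*-assoc 2 (20 * L) p ⟩
    2 ^ (20 * L * p)      ≡⟨ cong (2 ^_) (*-assoc 20 L p) ⟩
    2 ^ (20 * (L * p))    ≤⟨ ^-monoʳ-≤ 2 (*-monoʳ-≤ 20 (m/n*n≤m q p)) ⟩
    2 ^ (20 * q) ∎

  K≤n : K ≤ n
  K≤n = ^-cancelʳ-≤ p p>0 (begin
    K ^ p         ≤⟨ K^p≤ ⟩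
    2 ^ (20 * q)  ≤⟨ ^-monoʳ-≤ 2 (*-monoˡ-≤ q (toWitness {a? = 20 ≤? 40} _)) ⟩
    2 ^ (40 * q)  ≤⟨ <⇒≤ n>k² ⟩
    n ^ p ∎)

  n≤Λd : n ≤ Λ * d
  n≤Λd = +-cancelʳ-≤ L n (Λ * d) (begin
    n + L                        ≡⟨ m≡m%n+[m/n]*n (n + L) Λ ⟩
    (n + L) % Λ + d * Λ          ≤⟨ +-mono-≤ (≤-pred (m%n<n (n + L) Λ)) (≤-reflexive (*-comm d Λ)) ⟩
    L + Λ * d                    ≡⟨ +-comm L (Λ * d) ⟩
    Λ * d + L ∎)

  q≤Λp : q ≤ Λ * p
  q≤Λp = ≤-trans (≤-reflexive (m≡m%n+[m/n]*n q p)) (+-monoˡ-≤ (L * p) (<⇒≤ (m%n<n q p)))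

  -- The surplus `x` of the class is an integer that is at least `ε n`, hence at least `n / Λ`, and
  -- so at least `n / Λ` rounded up.
  large′ : ∀ c → n + d ≤ colourCount G col c
  large′ c = begin
    n + d         ≤⟨ +-monoʳ-≤ n (≤-pred (m<n*o⇒m/o<n (begin-strict
                       n + L          ≤⟨ +-monoˡ-≤ L n≤Λx ⟩
                       Λ * x + L      <⟨ +-monoʳ-< (Λ * x) (n<1+n L) ⟩
                       Λ * x + Λ      ≡⟨ trans (+-comm (Λ * x) Λ) (cong (Λ +_) (*-comm Λ x)) ⟩
                       suc x * Λ ∎))) ⟩
    n + x         ≡⟨ m+[n∸m]≡n n≤N ⟩
    N ∎
    where
    N x : ℕ
    N = colourCount G col c
    x = N ∸ n
    q>0 : 0 < q
    q>0 = ≤-<-trans z≤n 1000p<q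
    n≤N : n ≤ N
    n≤N = *-cancelˡ-≤ q {{>-nonZero q>0}} (≤-trans (*-monoˡ-≤ n (m≤m+n q p)) (large c))
    n≤Λx : n ≤ Λ * x
    n≤Λx = *-cancelˡ-≤ p (begin
      p * n             ≤⟨ m+n≤o⇒m≤o∸n (p * n) (≤-trans (≤-reflexive (trans (+-comm (p * n) (q * n)) (sym (*-distribʳ-+ n q p)))) (large c)) ⟩
      q * N ∸ q * n     ≡⟨ sym (*-distribˡ-∸ q N n) ⟩
      q * x             ≤⟨ *-monoˡ-≤ x q≤Λp ⟩
      Λ * p * x         ≡⟨ trans (cong (_* x) (*-comm Λ p)) (*-assoc p Λ x) ⟩
      p * (Λ * x) ∎)

  multiplicities′ : ∀ u w → multiplicity G u w * K ≤ n
  multiplicities′ u w = ^-cancelʳ-≤ p p>0 (begin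
    (multiplicity G u w * K) ^ p          ≡⟨ ^-distribʳ-* p (multiplicity G u w) K ⟩
    multiplicity G u w ^ p * K ^ p        ≤⟨ *-monoʳ-≤ (multiplicity G u w ^ p) K^p≤ ⟩
    multiplicity G u w ^ p * 2 ^ (20 * q) ≤⟨ multiplicities u w ⟩
    n ^ p ∎)

  found : ∃ λ M → length M ≡ n ∸ K × _
  found = rainbowMatching n d K≤n n≤Λd G col proper large′ multiplicities′ (n ∸ K) (≤-reflexive (m∸n+n≡m K≤n))

  M : List (Fin (E G))
  M = proj₁ found

  rm = proj₂ (proj₂ found)

  size : AtLeastNMinusK p q n (length M)
  size = begin
    (n ∸ length M) ^ p   ≡⟨ cong (λ l → (n ∸ l) ^ p) (proj₁ (proj₂ found)) ⟩
    (n ∸ (n ∸ K)) ^ p    ≡⟨ cong (_^ p) (m∸[m∸n]≡n K≤n) ⟩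
    K ^ p                ≤⟨ K^p≤ ⟩
    2 ^ (20 * q) ∎
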